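{- Let $d\ge 1$ and let $(f_0, f_1, \ldots, f_{d-1})$ be a finite sequence of integers with $f_i > 0$ for all $i$. Put $f_{ -1}=1$. The following conditions are equivalent: (i) there is a pure quasi-forest $\Delta$ of dimension $d-1$ with $f(\Delta) = (f_0, \ldots, f_{d-1})$; (ii) there is a pure forest $\Delta$ of dimension $d-1$ with $f(\Delta) = (f_0, \ldots, f_{d-1})$; (iii) the integers $c_0,\ldots,c_d$ defined by $\sum_{i=0}^{d} f_{i-1}(x-1)^{i} = \sum_{i=0}^{d} c_i x^i$ satisfy $\sum_{i=k}^{d} c_i > 0$ for each $1 \le k \le d$ and $c_i \le 0$ for each $1 \le i < d$; (iv) the integers $b_1,\ldots,b_d$ defined by $\sum_{i=1}^{d} f_{i-1}(x-1)^{i-1} = \sum_{i=1}^{d} b_i x^{i-1}$ satisfy $0 < b_1 \le b_2 \le \cdots \le b_d$.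
   Context: A simplicial complex $\Delta$ on $[n]=\{1,\ldots,n\}$ is a collection of subsets of $[n]$ such that $\{i\}\in\Delta$ for every $i\in[n]$ and $G\subset F\in\Delta$ implies $G\in\Delta$. If $d=\max\{|F|:F\in\Delta\}$, then $\dim\Delta=d-1$. Facets are maximal faces; $\Delta$ is pure if all facets have the same cardinality. The $f$-vector is $f(\Delta)=(f_0,\ldots,f_{d-1})$, where $f_i$ is the number of faces with $i+1$ elements. For facets $F_{i_1},\ldots,F_{i_q}$, $\langle F_{i_1},\ldots,F_{i_q}\rangle$ denotes the subcomplex of all faces contained in some $F_{i_j}$. A facet $F$ of $\Delta$ is a leaf if there is a facet $G\neq F$ (a branch of $F$) with $H\cap F\subset G\cap F$ for all facets $H\neq F$. A quasi-forest is a simplicial complex whose facets admit an ordering $F_1,\ldots,F_s$ (a leaf order) such that for each $1<j\le s$, $F_j$ is a leaf of $\langle F_1,\ldots,F_j\rangle$. A forest is a simplicial complex such that for every nonempty subset $\{F_{i_1},\ldots,F_{i_q}\}$ of its facets, $\langle F_{i_1},\ldots,F_{i_q}\rangle$ has a leaf. (A complex with a single facet is regarded as a quasi-forest and forest.) -}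

module Defs where

open import Data.Bool.Base using (if_then_else_)
open import Data.Fin.Base using (Fin; toℕ)
open import Data.Fin.Subset using (Subset; inside; outside; ⁅_⁆; _⊆_; _∩_; ∣_∣)
open import Data.Integer.Base as ℤ using (ℤ; +_; 0ℤ; 1ℤ; -1ℤ)
open import Data.List.Base using (List; []; _∷_; _++_; map; filter; length; take; lookup)
open import Data.List.Extrema.Nat using (max)
open import Data.List.Membership.Propositional using (_∈_)
open import Data.List.Relation.Unary.All using (All)
open import Data.List.Relation.Unary.Any using (Any)
open import Data.List.Relation.Unary.Unique.Propositional using (Unique)
open import Data.Nat as ℕ using (ℕ; zero; suc)
open import Data.Product.Base using (Σ; ∃; _×_)
open import Data.Sum.Base using (_⊎_)
import Data.Vec.Base as Vec
open import Data.Vec.Functional using (Vector; foldr) renaming (_∷_ to _◂_)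
open import Function.Bundles using (_⇔_)
open import Level using (0ℓ)
open import Relation.Binary.PropositionalEquality using (_≡_; _≢_)
open import Relation.Nullary.Decidable using (⌊_⌋)
open import Relation.Unary using (Pred; Decidable)

-- The vertex set [n] is Fin n.  Δ is a finite collection, so membership is
-- taken to be decidable.
record SimplicialComplex (n : ℕ) : Set₁ where
  field
    Face       : Pred (Subset n) 0ℓ
    Face?      : Decidable Face
    vertex     : ∀ i → Face ⁅ i ⁆
    downClosed : ∀ {F G} → G ⊆ F → Face F → Face G

open SimplicialComplex public

allSubsets : ∀ n → List (Subset n)
allSubsets zero    = Vec.[] ∷ []
allSubsets (suc n) = map (outside Vec.∷_) (allSubsets n) ++ map (inside Vec.∷_) (allSubsets n)

faces : ∀ {n} → SimplicialComplex n → List (Subset n)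
faces {n} Δ = filter (Face? Δ) (allSubsets n)

maxFaceSize : ∀ {n} → SimplicialComplex n → ℕ
maxFaceSize Δ = max 0 (map ∣_∣ (faces Δ))

dim : ∀ {n} → SimplicialComplex n → ℤ
dim Δ = + maxFaceSize Δ ℤ.- 1ℤ

fNumber : ∀ {n} → SimplicialComplex n → ℕ → ℕ
fNumber Δ i = length (filter (λ F → ∣ F ∣ ℕ.≟ suc i) (faces Δ))

-- Facets and leaves are defined for an arbitrary family of subsets of [n]
-- because a subcomplex ⟨F₁,…,F_q⟩ need not contain every vertex of [n], and
-- hence need not be a SimplicialComplex n.

module _ {n : ℕ} (K : Pred (Subset n) 0ℓ) where

  IsFacet : Pred (Subset n) 0ℓ
  IsFacet F = K F × (∀ G → K G → F ⊆ G → G ≡ F)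

  IsLeaf : Pred (Subset n) 0ℓ
  IsLeaf F = IsFacet F × ∃ λ G →
    IsFacet G × G ≢ F × (∀ H → IsFacet H → H ≢ F → H ∩ F ⊆ G ∩ F)

  HasSingleFacet : Set
  HasSingleFacet = ∃ λ F → IsFacet F × (∀ G → IsFacet G → G ≡ F)

infix 8 _⟨_⟩

_⟨_⟩ : ∀ {n} → SimplicialComplex n → List (Subset n) → Pred (Subset n) 0ℓ
(Δ ⟨ Fs ⟩) G = Face Δ G × Any (G ⊆_) Fs

IsPure : ∀ {n} → SimplicialComplex n → Set
IsPure Δ = ∀ F G → IsFacet (Face Δ) F → IsFacet (Face Δ) G → ∣ F ∣ ≡ ∣ G ∣

-- The leaf condition ranges over 1 < j ≤ s; here j is the 0-based position.
IsLeafOrder : ∀ {n} → SimplicialComplex n → List (Subset n) → Set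
IsLeafOrder Δ Fs =
    Unique Fs
  × (∀ F → F ∈ Fs ⇔ IsFacet (Face Δ) F)
  × (∀ (j : Fin (length Fs)) → 0 ℕ.< toℕ j →
       IsLeaf (Δ ⟨ take (suc (toℕ j)) Fs ⟩) (lookup Fs j))

IsQuasiForest : ∀ {n} → SimplicialComplex n → Set
IsQuasiForest Δ = ∃ (IsLeafOrder Δ)

-- A leaf needs a branch G ≢ F, so a complex with one facet has none; by
-- convention it nevertheless counts as a forest, whence the first alternative.
-- Subsets of the set of facets are given by lists (repetitions are harmless).
IsForest : ∀ {n} → SimplicialComplex n → Set
IsForest Δ = ∀ Fs → Fs ≢ [] → All (IsFacet (Face Δ)) Fs →
  HasSingleFacet (Δ ⟨ Fs ⟩) ⊎ ∃ (IsLeaf (Δ ⟨ Fs ⟩))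

HasDimAndFVector : ∀ {n} → SimplicialComplex n → (d : ℕ) → Vector ℤ d → Set
HasDimAndFVector Δ d f =
    dim Δ ≡ + d ℤ.- 1ℤ
  × (∀ (i : Fin d) → + fNumber Δ (toℕ i) ≡ f i)

-- Polynomials over ℤ: coefficient lists, constant term first, compared by
-- coefficients so that trailing zeros do not matter.

Poly : Set
Poly = List ℤ

coeff : Poly → ℕ → ℤ
coeff []      _       = 0ℤ
coeff (a ∷ p) zero    = a
coeff (a ∷ p) (suc i) = coeff p i

infix 4 _≈ₚ_

_≈ₚ_ : Poly → Poly → Set
p ≈ₚ q = ∀ i → coeff p i ≡ coeff q i

infixl 6 _+ₚ_
infixl 7 _*ₚ_ _·ₚ_
infixr 8 _^ₚ_

_+ₚ_ : Poly → Poly → Poly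
[]      +ₚ q       = q
(a ∷ p) +ₚ []      = a ∷ p
(a ∷ p) +ₚ (b ∷ q) = (a ℤ.+ b) ∷ (p +ₚ q)

_·ₚ_ : ℤ → Poly → Poly
a ·ₚ p = map (a ℤ.*_) p

_*ₚ_ : Poly → Poly → Poly
[]      *ₚ q = []
(a ∷ p) *ₚ q = (a ·ₚ q) +ₚ (0ℤ ∷ (p *ₚ q))

_^ₚ_ : Poly → ℕ → Poly
p ^ₚ zero  = 1ℤ ∷ []
p ^ₚ suc i = p *ₚ (p ^ₚ i)

X X-1 : Poly
X   = 0ℤ ∷ 1ℤ ∷ []
X-1 = -1ℤ ∷ 1ℤ ∷ []

-- expand a p is the polynomial Σ_{0≤i<m} aᵢ pⁱ.
expand : ∀ {m} → Vector ℤ m → Poly → Poly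
expand a p = foldr _+ₚ_ [] (λ i → a i ·ₚ (p ^ₚ toℕ i))

sumFrom : ∀ {m} → ℕ → Vector ℤ m → ℤ
sumFrom k c = foldr ℤ._+_ 0ℤ (λ i → if ⌊ k ℕ.≤? toℕ i ⌋ then c i else 0ℤ)

PureQuasiForestExists : (d : ℕ) → Vector ℤ d → Set₁
PureQuasiForestExists d f = Σ ℕ λ n → Σ (SimplicialComplex n) λ Δ →
  IsPure Δ × IsQuasiForest Δ × HasDimAndFVector Δ d f

PureForestExists : (d : ℕ) → Vector ℤ d → Set₁
PureForestExists d f = Σ ℕ λ n → Σ (SimplicialComplex n) λ Δ →
  IsPure Δ × IsForest Δ × HasDimAndFVector Δ d f

-- The identity determines c uniquely.  Since f₋₁ = 1, the entry of 1ℤ ◂ f at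
-- position i is f_{i-1}.
CCondition : (d : ℕ) → Vector ℤ d → Set
CCondition d f = Σ (Vector ℤ (suc d)) λ c →
    expand (1ℤ ◂ f) X-1 ≈ₚ expand c X
  × (∀ k → 1 ℕ.≤ k → k ℕ.≤ d → 0ℤ ℤ.< sumFrom k c)
  × (∀ i → 1 ℕ.≤ toℕ i → toℕ i ℕ.< d → c i ℤ.≤ 0ℤ)

-- The identity determines b uniquely; b_{i+1} is the entry of b at position i.
BCondition : (d : ℕ) → Vector ℤ d → Set
BCondition d f = Σ (Vector ℤ d) λ b →
    expand f X-1 ≈ₚ expand b X
  × (∀ i → toℕ i ≡ 0 → 0ℤ ℤ.< b i)
  × (∀ i j → toℕ j ≡ suc (toℕ i) → b i ℤ.≤ b j)

{-# OPTIONS --safe #-}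
module Submission where

-- In a leaf order of a pure quasi-forest of dimension d − 1, let δ be the number
-- of vertices in which a facet F meets its branch.  Attaching F adds the subsets
-- of F not contained in that intersection, so it adds xᵈ − x^δ to Σ f_{i−1} (x−1)ⁱ,
-- that is, x^δ + ⋯ + x^{d−1} to Σ bᵢ x^{i−1}.  Starting from one facet, this gives
-- b_{k+1} = 1 + #{δ ≤ k}, which is positive and nondecreasing in k.  Conversely such
-- a sequence b prescribes the multiset of the δ; taking them in decreasing order
-- and gluing each new facet along δ vertices common to all earlier ones gives a
-- forest, because each facet meets all earlier ones in the same set.

open import Defs
import Algebra.Properties.AbelianGroup
import Data.Bool.Properties as Bool
open import Data.Bool.Base using (if_then_else_)
open import Data.Fin.Base as Fin using (Fin; toℕ)
open import Data.Fin.Properties using (toℕ<n; toℕ-fromℕ<; splitAt⁻¹-↑ˡ; splitAt⁻¹-↑ʳ)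
open import Data.Fin.Subset using (Subset; inside; outside; ⊤; ⊥; _⊆_; _∩_; ∣_∣) renaming (_∈_ to _∈ₛ_)
open import Data.Fin.Subset.Properties
  using ( _⊆?_; ⊆-refl; ⊆-trans; ⊆-antisym; ∈⊤; drop-∷-⊆; out⊆; s⊆s; p⊆q⇒∣p∣≤∣q∣; p∩q⊆p; p∩q⊆q
        ; x∈p∩q⁺; ∣p∩q∣≤∣q∣; ∣⊤∣≡n; ∣⊥∣≡0; ⊥⊆; x∈⁅y⁆⇒x≡y)
open import Data.Integer.Base as ℤ using (ℤ; +_; 0ℤ; 1ℤ; -1ℤ; _<_)
import Data.Integer.Properties as ℤ
open import Data.Integer.Tactic.RingSolver using (solve-∀)
open import Data.List.Base using (List; []; _∷_; _++_; _∷ʳ_; map; filter; length; take; lookup; replicate)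
open import Data.List.Extrema.Nat using (argmax; argmax-sel; max≤v⁺; xs≤max; f[xs]≤f[argmax])
open import Data.List.Membership.Propositional using (_∈_; find; lose)
open import Data.List.Membership.Propositional.Properties
  using (∈-map⁺; ∈-map⁻; ∈-filter⁺; ∈-filter⁻; ∈-++⁺ˡ; ∈-++⁺ʳ; ∈-++⁻)
open import Data.List.Properties
  using (filter-++; filter-≐; filter-none; filter-notAll; length-++; ++-assoc)
open import Data.List.Relation.Unary.All as All using (All; []; _∷_)
import Data.List.Relation.Unary.All.Properties as All
open import Data.List.Relation.Unary.AllPairs as AllPairs using (AllPairs; []; _∷_)
import Data.List.Relation.Unary.AllPairs.Properties as AllPairs
open import Data.List.Relation.Unary.Any as Any using (Any; here; there; any?)
open import Data.List.Relation.Unary.Any.Properties using (¬Any[])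
open import Data.List.Relation.Unary.Unique.Propositional using (Unique)
import Data.List.Relation.Unary.Unique.Propositional.Properties as Unique
open import Data.Nat.Base as ℕ using (ℕ; zero; suc; z≤n; s≤s; _≤_)
open import Data.Nat.Combinatorics
  using (_C_; nC1≡n; nCn≡1; nCk≡nC[n∸k]; nCk+nC[k+1]≡[n+1]C[k+1]; k>n⇒nCk≡0)
import Data.Nat.Properties as ℕ
open import Data.Product.Base using (_×_; _,_; proj₁; proj₂; ∃; ∃₂)
open import Data.Sum.Base as Sum using (_⊎_; inj₁; inj₂; [_,_])
import Data.Vec.Base as Vec
open import Data.Vec.Functional using (Vector; tail; foldr) renaming (_∷_ to _◂_)
import Data.Vec.Properties as Vec
open import Function.Base using (_∘_; id)
open import Function.Bundles using (_⇔_; mk⇔; Equivalence)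
open import Level using (0ℓ)
open import Relation.Binary.Definitions using (DecidableEquality)
open import Relation.Binary.PropositionalEquality
  using (_≡_; _≢_; _≗_; refl; sym; trans; cong; cong₂; subst; subst₂; module ≡-Reasoning)
open import Relation.Nullary using (¬_; yes; no; contradiction; ¬?)
open import Relation.Nullary.Decidable using (⌊_⌋)
open import Relation.Unary using (Pred; Decidable; _≐_)
open import Relation.Unary.Properties using (_∪?_; _∩?_)

open Algebra.Properties.AbelianGroup ℤ.+-0-abelianGroup
  using () renaming (∙-cancelʳ to +-cancelʳ-≡)
open Equivalence using (to; from)

-- Coefficients of polynomials in x − 1

-- `PositiveMonotone` is the hub: (iii) and (iv) are each equivalent to it by algebra, and (ii) ⇒
-- (i) ⇒ `PositiveMonotone` ⇒ (ii) closes the geometric cycle. For (iii), the polynomial with f₋₁ =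
-- 1 in front is 1 + (x - 1) Σ b_{k+1} xᵏ, so each cᵢ is a difference of consecutive b's and the
-- tail sums of c telescope back to b. A prescribed b fixes the δ only through the expansion in x -
-- 1, so realising f itself also needs that a vector is determined by that expansion. Purity enters
-- through cardinalities: sets of equal size that generate a complex are exactly its facets, so leaf
-- conditions become statements about membership in lists.

coeff-+ₚ : ∀ p q k → coeff (p +ₚ q) k ≡ coeff p k ℤ.+ coeff q k
coeff-+ₚ []      q       k       = sym (ℤ.+-identityˡ _)
coeff-+ₚ (a ∷ p) []      k       = sym (ℤ.+-identityʳ _)
coeff-+ₚ (a ∷ p) (b ∷ q) zero    = refl
coeff-+ₚ (a ∷ p) (b ∷ q) (suc k) = coeff-+ₚ p q k

coeff-·ₚ : ∀ a p k → coeff (a ·ₚ p) k ≡ a ℤ.* coeff p k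
coeff-·ₚ a []      k       = sym (ℤ.*-zeroʳ a)
coeff-·ₚ a (b ∷ p) zero    = refl
coeff-·ₚ a (b ∷ p) (suc k) = coeff-·ₚ a p k

[_+x]* : ℤ → (ℕ → ℤ) → ℕ → ℤ
[ s +x]* g zero    = s ℤ.* g zero
[ s +x]* g (suc k) = g k ℤ.+ s ℤ.* g (suc k)

coeff-linear* : ∀ s q k → coeff ((s ∷ 1ℤ ∷ []) *ₚ q) k ≡ [ s +x]* (coeff q) k
coeff-linear* s q zero = begin
  coeff ((s ·ₚ q) +ₚ (0ℤ ∷ _)) 0  ≡⟨ coeff-+ₚ (s ·ₚ q) _ 0 ⟩
  coeff (s ·ₚ q) 0 ℤ.+ 0ℤ         ≡⟨ ℤ.+-identityʳ _ ⟩
  coeff (s ·ₚ q) 0                ≡⟨ coeff-·ₚ s q 0 ⟩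
  s ℤ.* coeff q 0                 ∎
  where open ≡-Reasoning
coeff-linear* s q (suc k) = begin
  coeff ((s ·ₚ q) +ₚ (0ℤ ∷ ((1ℤ ·ₚ q) +ₚ (0ℤ ∷ [])))) (suc k)
    ≡⟨ coeff-+ₚ (s ·ₚ q) _ (suc k) ⟩
  coeff (s ·ₚ q) (suc k) ℤ.+ coeff ((1ℤ ·ₚ q) +ₚ (0ℤ ∷ [])) k
    ≡⟨ cong₂ ℤ._+_ (coeff-·ₚ s q (suc k)) (coeff-+ₚ (1ℤ ·ₚ q) (0ℤ ∷ []) k) ⟩
  s ℤ.* coeff q (suc k) ℤ.+ (coeff (1ℤ ·ₚ q) k ℤ.+ coeff (0ℤ ∷ []) k)
    ≡⟨ cong₂ (λ u v → s ℤ.* coeff q (suc k) ℤ.+ (u ℤ.+ v)) (coeff-·ₚ 1ℤ q k) (zeroPoly k) ⟩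
  s ℤ.* coeff q (suc k) ℤ.+ (1ℤ ℤ.* coeff q k ℤ.+ 0ℤ)
    ≡⟨ rearrange (s ℤ.* coeff q (suc k)) (coeff q k) ⟩
  coeff q k ℤ.+ s ℤ.* coeff q (suc k) ∎
  where
  open ≡-Reasoning
  zeroPoly : ∀ k → coeff (0ℤ ∷ []) k ≡ 0ℤ
  zeroPoly zero    = refl
  zeroPoly (suc k) = refl
  rearrange : ∀ u v → u ℤ.+ (1ℤ ℤ.* v ℤ.+ 0ℤ) ≡ v ℤ.+ u
  rearrange = solve-∀

[+x]*-cong : ∀ s {g h} → g ≗ h → [ s +x]* g ≗ [ s +x]* h
[+x]*-cong s g≗h zero    = cong (s ℤ.*_) (g≗h 0)
[+x]*-cong s g≗h (suc k) = cong₂ (λ u v → u ℤ.+ s ℤ.* v) (g≗h k) (g≗h (suc k))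

-- The coefficients of Σ aᵢ (s + x)ⁱ, by Horner's scheme.
shifted : ∀ {m} → ℤ → Vector ℤ m → ℕ → ℤ
shifted {zero}  s a k       = 0ℤ
shifted {suc m} s a zero    = a Fin.zero ℤ.+ [ s +x]* (shifted s (tail a)) zero
shifted {suc m} s a (suc k) = [ s +x]* (shifted s (tail a)) (suc k)

-- Pulling the common factor `s + x` out of the higher terms is what turns `expand` into Horner's
-- scheme. The `q i` are arbitrary because the powers move up by one at each step of the induction.
coeff-sum-linear* : ∀ {m} s (a : Vector ℤ m) (q : Fin m → Poly) k →
  coeff (foldr _+ₚ_ [] (λ i → a i ·ₚ ((s ∷ 1ℤ ∷ []) *ₚ q i))) k ≡
  [ s +x]* (coeff (foldr _+ₚ_ [] (λ i → a i ·ₚ q i))) k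
coeff-sum-linear* {zero}  s a q zero    = sym (ℤ.*-zeroʳ s)
coeff-sum-linear* {zero}  s a q (suc k) = sym (trans (ℤ.+-identityˡ _) (ℤ.*-zeroʳ s))
coeff-sum-linear* {suc m} s a q k = begin
  coeff ((a₀ ·ₚ (ℓ *ₚ q₀)) +ₚ _) k
    ≡⟨ coeff-+ₚ (a₀ ·ₚ (ℓ *ₚ q₀)) _ k ⟩
  coeff (a₀ ·ₚ (ℓ *ₚ q₀)) k ℤ.+ _
    ≡⟨ cong₂ ℤ._+_ (trans (coeff-·ₚ a₀ (ℓ *ₚ q₀) k) (cong (a₀ ℤ.*_) (coeff-linear* s q₀ k)))
                   (coeff-sum-linear* s (tail a) (λ i → q (Fin.suc i)) k) ⟩
  a₀ ℤ.* [ s +x]* (coeff q₀) k ℤ.+ [ s +x]* (coeff r) k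
    ≡⟨ linear (coeff q₀) (coeff r) k ⟩
  [ s +x]* (λ j → a₀ ℤ.* coeff q₀ j ℤ.+ coeff r j) k
    ≡⟨ [+x]*-cong s (λ j → sym (trans (coeff-+ₚ (a₀ ·ₚ q₀) r j)
                                      (cong (ℤ._+ coeff r j) (coeff-·ₚ a₀ q₀ j)))) k ⟩
  [ s +x]* (coeff ((a₀ ·ₚ q₀) +ₚ r)) k ∎
  where
  open ≡-Reasoning
  ℓ  = s ∷ 1ℤ ∷ []
  a₀ = a Fin.zero
  q₀ = q Fin.zero
  r  = foldr _+ₚ_ [] (λ i → a (Fin.suc i) ·ₚ q (Fin.suc i))
  linear₀ : ∀ c s u v → c ℤ.* (s ℤ.* u) ℤ.+ s ℤ.* v ≡ s ℤ.* (c ℤ.* u ℤ.+ v)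
  linear₀ = solve-∀
  linear₊ : ∀ c s u v u′ v′ → c ℤ.* (u ℤ.+ s ℤ.* u′) ℤ.+ (v ℤ.+ s ℤ.* v′) ≡
                              (c ℤ.* u ℤ.+ v) ℤ.+ s ℤ.* (c ℤ.* u′ ℤ.+ v′)
  linear₊ = solve-∀
  linear : ∀ g h k → a₀ ℤ.* [ s +x]* g k ℤ.+ [ s +x]* h k ≡
                     [ s +x]* (λ j → a₀ ℤ.* g j ℤ.+ h j) k
  linear g h zero    = linear₀ a₀ s (g 0) (h 0)
  linear g h (suc k) = linear₊ a₀ s (g k) (h k) (g (suc k)) (h (suc k))

-- One statement serves both sides of the identities in (iii) and (iv): `X-1` is the case `s = -1ℤ`
-- and `X` the case `s = 0ℤ`.
coeff-expand : ∀ {m} s (a : Vector ℤ m) k → coeff (expand a (s ∷ 1ℤ ∷ [])) k ≡ shifted s a k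
coeff-expand {zero}  s a k = refl
coeff-expand {suc m} s a k = begin
  coeff (expand a ℓ) k
    ≡⟨ coeff-+ₚ (a Fin.zero ·ₚ (1ℤ ∷ [])) higher k ⟩
  coeff (a Fin.zero ·ₚ (1ℤ ∷ [])) k ℤ.+ coeff higher k
    ≡⟨ cong₂ ℤ._+_ {x = coeff (a Fin.zero ·ₚ (1ℤ ∷ [])) k} refl
         (trans (coeff-sum-linear* s (tail a) (λ i → ℓ ^ₚ toℕ i) k)
                ([+x]*-cong s (coeff-expand s (tail a)) k)) ⟩
  coeff (a Fin.zero ·ₚ (1ℤ ∷ [])) k ℤ.+ [ s +x]* (shifted s (tail a)) k
    ≡⟨ constant k ⟩
  shifted s a k ∎
  where
  open ≡-Reasoning
  ℓ = s ∷ 1ℤ ∷ []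
  higher = foldr _+ₚ_ [] (λ i → tail a i ·ₚ (ℓ *ₚ (ℓ ^ₚ toℕ i)))
  constant : ∀ k → coeff (a Fin.zero ·ₚ (1ℤ ∷ [])) k ℤ.+ [ s +x]* (shifted s (tail a)) k
                   ≡ shifted s a k
  constant zero    = cong (ℤ._+ [ s +x]* (shifted s (tail a)) 0) (ℤ.*-identityʳ (a Fin.zero))
  constant (suc k) = ℤ.+-identityˡ _

shifted-degree : ∀ {m} s (a : Vector ℤ m) k → m ℕ.≤ k → shifted s a k ≡ 0ℤ
shifted-degree {zero}  s a k       _         = refl
shifted-degree {suc m} s a (suc k) (s≤s m≤k)
  rewrite shifted-degree s (tail a) k m≤k
        | shifted-degree s (tail a) (suc k) (ℕ.m≤n⇒m≤1+n m≤k) =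
  trans (ℤ.+-identityˡ _) (ℤ.*-zeroʳ s)

shifted-cong : ∀ {m} s {a b : Vector ℤ m} → a ≗ b → shifted s a ≗ shifted s b
shifted-cong {zero}  s a≗b k       = refl
shifted-cong {suc m} s a≗b zero    =
  cong₂ ℤ._+_ (a≗b Fin.zero) ([+x]*-cong s (shifted-cong s (λ i → a≗b (Fin.suc i))) 0)
shifted-cong {suc m} s a≗b (suc k) = [+x]*-cong s (shifted-cong s (λ i → a≗b (Fin.suc i))) (suc k)

shifted-+ : ∀ {m} s (a b : Vector ℤ m) k →
  shifted s (λ i → a i ℤ.+ b i) k ≡ shifted s a k ℤ.+ shifted s b k
shifted-+ {zero}  s a b k       = refl
shifted-+ {suc m} s a b zero
  rewrite shifted-+ s (tail a) (tail b) 0 = rearrange (a Fin.zero) (b Fin.zero) s _ _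
  where
  rearrange : ∀ a b s u v → a ℤ.+ b ℤ.+ s ℤ.* (u ℤ.+ v) ≡ (a ℤ.+ s ℤ.* u) ℤ.+ (b ℤ.+ s ℤ.* v)
  rearrange = solve-∀
shifted-+ {suc m} s a b (suc k)
  rewrite shifted-+ s (tail a) (tail b) k | shifted-+ s (tail a) (tail b) (suc k) =
  rearrange s (shifted s (tail a) k) _ _ _
  where
  rearrange : ∀ s u v u′ v′ → (u ℤ.+ v) ℤ.+ s ℤ.* (u′ ℤ.+ v′) ≡ (u ℤ.+ s ℤ.* u′) ℤ.+ (v ℤ.+ s ℤ.* v′)
  rearrange = solve-∀

shifted-- : ∀ {m} s (a b : Vector ℤ m) k →
  shifted s (λ i → a i ℤ.- b i) k ≡ shifted s a k ℤ.- shifted s b k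
shifted-- s a b k = begin
  shifted s (λ i → a i ℤ.- b i) k                                ≡⟨ add-sub _ (shifted s b k) ⟩
  shifted s (λ i → a i ℤ.- b i) k ℤ.+ shifted s b k ℤ.- shifted s b k
    ≡⟨ cong (ℤ._- shifted s b k) (sym (shifted-+ s (λ i → a i ℤ.- b i) b k)) ⟩
  shifted s (λ i → a i ℤ.- b i ℤ.+ b i) k ℤ.- shifted s b k
    ≡⟨ cong (ℤ._- shifted s b k) (shifted-cong s (λ i → sub-add (a i) (b i)) k) ⟩
  shifted s a k ℤ.- shifted s b k ∎
  where
  open ≡-Reasoning
  add-sub : ∀ u v → u ≡ u ℤ.+ v ℤ.- v
  add-sub = solve-∀
  sub-add : ∀ u v → u ℤ.- v ℤ.+ v ≡ u
  sub-add = solve-∀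

shifted-0 : ∀ {m} (a : Vector ℤ m) i → shifted 0ℤ a (toℕ i) ≡ a i
shifted-0 a Fin.zero    = ℤ.+-identityʳ _
shifted-0 a (Fin.suc i) = trans (ℤ.+-identityʳ _) (shifted-0 (tail a) i)

-- Since the coefficient sequences have finite support, g ↦ (x − 1) g is
-- injective on them: compare coefficients from the top down.
[-1+x]*-injective : ∀ {g h : ℕ → ℤ} N → (∀ k → N ℕ.≤ k → g k ≡ h k) →
  (∀ k → [ -1ℤ +x]* g (suc k) ≡ [ -1ℤ +x]* h (suc k)) → g ≗ h
[-1+x]*-injective zero    top eq k = top k z≤n
[-1+x]*-injective {g} {h} (suc N) top eq = [-1+x]*-injective N top′ eq
  where
  open ≡-Reasoning
  restore : ∀ u v → u ≡ (u ℤ.+ -1ℤ ℤ.* v) ℤ.+ v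
  restore = solve-∀
  atN : g N ≡ h N
  atN = begin
    g N                                          ≡⟨ restore (g N) (g (suc N)) ⟩
    [ -1ℤ +x]* g (suc N) ℤ.+ g (suc N)           ≡⟨ cong₂ ℤ._+_ (eq N) (top (suc N) ℕ.≤-refl) ⟩
    [ -1ℤ +x]* h (suc N) ℤ.+ h (suc N)           ≡⟨ restore (h N) (h (suc N)) ⟨
    h N                                          ∎
  top′ : ∀ k → N ℕ.≤ k → g k ≡ h k
  top′ k N≤k with N ℕ.≟ k
  ... | yes refl = atN
  ... | no N≢k   = top k (ℕ.≤∧≢⇒< N≤k N≢k)

-- Coefficients of positive index do not involve the constant term `a Fin.zero`, so they determine
-- the tail; the constant term then follows by cancellation.
shifted-injective : ∀ {m} (a b : Vector ℤ m) → shifted -1ℤ a ≗ shifted -1ℤ b → a ≗ b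
shifted-injective {suc m} a b eq = λ where
    Fin.zero    → +-cancelʳ-≡ _ _ _
                    (trans (eq 0) (cong (λ u → b Fin.zero ℤ.+ -1ℤ ℤ.* u) (sym (tails 0))))
    (Fin.suc i) → shifted-injective (tail a) (tail b) tails i
  where
  tails : shifted -1ℤ (tail a) ≗ shifted -1ℤ (tail b)
  tails = [-1+x]*-injective m
    (λ k m≤k → trans (shifted-degree -1ℤ (tail a) k m≤k) (sym (shifted-degree -1ℤ (tail b) k m≤k)))
    (λ k → eq (suc k))

shifted-zero : ∀ {m} s {a : Vector ℤ m} → (∀ i → a i ≡ 0ℤ) → ∀ k → shifted s a k ≡ 0ℤ
shifted-zero {zero}  s a≡0 k = refl
shifted-zero {suc m} s a≡0 zero
  rewrite a≡0 Fin.zero | shifted-zero s (λ i → a≡0 (Fin.suc i)) 0 =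
  trans (ℤ.+-identityˡ _) (ℤ.*-zeroʳ s)
shifted-zero {suc m} s a≡0 (suc k)
  rewrite shifted-zero s (λ i → a≡0 (Fin.suc i)) k
        | shifted-zero s (λ i → a≡0 (Fin.suc i)) (suc k) =
  trans (ℤ.+-identityˡ _) (ℤ.*-zeroʳ s)

-- Geometric sums as binomial expansions in x - 1

-- Recursion instead of a decision on `k < m` makes a simultaneous shift of both arguments
-- definitional; Pascal's induction and `count≤-map-suc-suc` rely on this.
ind< : ℕ → ℕ → ℤ
ind< k       zero    = 0ℤ
ind< zero    (suc m) = 1ℤ
ind< (suc k) (suc m) = ind< k m

ind<-yes : ∀ {k m} → k ℕ.< m → ind< k m ≡ 1ℤ
ind<-yes {zero}  (s≤s _)   = refl
ind<-yes {suc k} (s≤s k<m) = ind<-yes k<m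

ind<≤1 : ∀ k m → ind< k m ℤ.≤ 1ℤ
ind<≤1 k       zero    = ℤ.+≤+ z≤n
ind<≤1 zero    (suc m) = ℤ.≤-refl
ind<≤1 (suc k) (suc m) = ind<≤1 k m

ind<-antitone : ∀ k m → ind< (suc k) m ℤ.≤ ind< k m
ind<-antitone k       zero    = ℤ.≤-refl
ind<-antitone zero    (suc m) = ind<≤1 0 m
ind<-antitone (suc k) (suc m) = ind<-antitone k m

binomials : ∀ d → ℕ → Vector ℤ d
binomials d m i = + (m C suc (toℕ i))

-- Σ C(m,i+1) (x−1)ⁱ = (xᵐ − 1)/(x − 1) = 1 + x + ⋯ + x^{m−1}
shifted-binomials : ∀ d m → m ℕ.≤ d → ∀ k → shifted -1ℤ (binomials d m) k ≡ ind< k m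
shifted-binomials d zero _ k =
  shifted-zero -1ℤ {binomials d 0} (λ i → cong +_ (k>n⇒nCk≡0 {0} {suc (toℕ i)} (s≤s z≤n))) k
shifted-binomials (suc d) (suc m) (s≤s m≤d) = λ where
    zero → begin
      + (suc m C 1) ℤ.+ -1ℤ ℤ.* shifted -1ℤ (tail (binomials (suc d) (suc m))) 0
        ≡⟨ cong₂ (λ u v → + u ℤ.+ -1ℤ ℤ.* v) (nC1≡n (suc m)) (pascal 0) ⟩
      + suc m ℤ.+ -1ℤ ℤ.* (U 0 ℤ.+ V 0)
        ≡⟨ zero-step (+ m) (U 0) (V 0) ⟩
      (+ m ℤ.+ -1ℤ ℤ.* V 0) ℤ.+ (1ℤ ℤ.- U 0)
        ≡⟨ cong₂ (λ u v → (+ u ℤ.+ -1ℤ ℤ.* V 0) ℤ.+ (1ℤ ℤ.- v)) (sym (nC1≡n m))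
             (shifted-binomials d m m≤d 0) ⟩
      shifted -1ℤ (binomials (suc d) m) 0 ℤ.+ (1ℤ ℤ.- ind< 0 m)
        ≡⟨ cong (ℤ._+ (1ℤ ℤ.- ind< 0 m)) (IH 0) ⟩
      ind< 0 m ℤ.+ (1ℤ ℤ.- ind< 0 m)
        ≡⟨ cancel (ind< 0 m) 1ℤ ⟩
      1ℤ ∎
    (suc k) → begin
      [ -1ℤ +x]* (shifted -1ℤ (tail (binomials (suc d) (suc m)))) (suc k)
        ≡⟨ [+x]*-cong -1ℤ pascal (suc k) ⟩
      (U k ℤ.+ V k) ℤ.+ -1ℤ ℤ.* (U (suc k) ℤ.+ V (suc k))
        ≡⟨ suc-step (U k) (V k) (U (suc k)) (V (suc k)) ⟩
      (V k ℤ.+ -1ℤ ℤ.* V (suc k)) ℤ.+ (U k ℤ.- U (suc k))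
        ≡⟨ cong₂ ℤ._+_ (IH (suc k))
             (cong₂ ℤ._-_ (shifted-binomials d m m≤d k) (shifted-binomials d m m≤d (suc k))) ⟩
      ind< (suc k) m ℤ.+ (ind< k m ℤ.- ind< (suc k) m)
        ≡⟨ cancel (ind< (suc k) m) (ind< k m) ⟩
      ind< k m ∎
  where
  open ≡-Reasoning
  U V : ℕ → ℤ
  U = shifted -1ℤ (binomials d m)
  V = shifted -1ℤ (tail (binomials (suc d) m))
  IH = shifted-binomials (suc d) m (ℕ.m≤n⇒m≤1+n m≤d)
  -- By Pascal's rule row `suc m` exceeds row `m` by 1 + (x - 1) `U`, where `U` is the sum for `m`
  -- on a vector shorter by one; this difference is xᵐ.
  pascal : ∀ k → shifted -1ℤ (tail (binomials (suc d) (suc m))) k ≡ U k ℤ.+ V k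
  pascal k = trans
    (shifted-cong {d} -1ℤ (λ i → trans (cong +_ (sym (nCk+nC[k+1]≡[n+1]C[k+1] m (suc (toℕ i)))))
                                   (ℤ.pos-+ (m C suc (toℕ i)) (m C suc (suc (toℕ i))))) k)
    (shifted-+ -1ℤ (binomials d m) (tail (binomials (suc d) m)) k)
  zero-step : ∀ m u v → (1ℤ ℤ.+ m) ℤ.+ -1ℤ ℤ.* (u ℤ.+ v) ≡ (m ℤ.+ -1ℤ ℤ.* v) ℤ.+ (1ℤ ℤ.- u)
  zero-step = solve-∀
  suc-step : ∀ u v u′ v′ → (u ℤ.+ v) ℤ.+ -1ℤ ℤ.* (u′ ℤ.+ v′) ≡
                           (v ℤ.+ -1ℤ ℤ.* v′) ℤ.+ (u ℤ.- u′)
  suc-step = solve-∀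
  cancel : ∀ u v → u ℤ.+ (v ℤ.- u) ≡ v
  cancel = solve-∀

-- Conditions (iii) and (iv) in terms of the numbers b

module _ {m : ℕ} (a b : Vector ℤ m) where

  expansion⇒coeffs : expand a X-1 ≈ₚ expand b X → ∀ i → b i ≡ shifted -1ℤ a (toℕ i)
  expansion⇒coeffs eq i = begin
    b i                        ≡⟨ shifted-0 b i ⟨
    shifted 0ℤ b (toℕ i)       ≡⟨ coeff-expand 0ℤ b (toℕ i) ⟨
    coeff (expand b X) (toℕ i) ≡⟨ eq (toℕ i) ⟨
    coeff (expand a X-1) (toℕ i) ≡⟨ coeff-expand -1ℤ a (toℕ i) ⟩
    shifted -1ℤ a (toℕ i)      ∎
    where open ≡-Reasoning

  coeffs⇒expansion : (∀ i → b i ≡ shifted -1ℤ a (toℕ i)) → expand a X-1 ≈ₚ expand b X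
  coeffs⇒expansion b≡ k = begin
    coeff (expand a X-1) k ≡⟨ coeff-expand -1ℤ a k ⟩
    shifted -1ℤ a k        ≡⟨ same ⟩
    shifted 0ℤ b k         ≡⟨ coeff-expand 0ℤ b k ⟨
    coeff (expand b X) k   ∎
    where
    open ≡-Reasoning
    same : shifted -1ℤ a k ≡ shifted 0ℤ b k
    same with k ℕ.<? m
    ... | no k≮m  = trans (shifted-degree -1ℤ a k (ℕ.≮⇒≥ k≮m)) (sym (shifted-degree 0ℤ b k (ℕ.≮⇒≥ k≮m)))
    ... | yes k<m = subst (λ j → shifted -1ℤ a j ≡ shifted 0ℤ b j) (toℕ-fromℕ< k<m)
                      (sym (trans (shifted-0 b (Fin.fromℕ< k<m)) (b≡ (Fin.fromℕ< k<m))))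

if-≤-suc : ∀ k i (x : ℤ) →
  (if ⌊ suc k ℕ.≤? suc i ⌋ then x else 0ℤ) ≡ (if ⌊ k ℕ.≤? i ⌋ then x else 0ℤ)
if-≤-suc k i x with suc k ℕ.≤? suc i | k ℕ.≤? i
... | yes _       | yes _   = refl
... | no _        | no _    = refl
... | yes 1+k≤1+i | no k≰i  = contradiction (ℕ.s≤s⁻¹ 1+k≤1+i) k≰i
... | no 1+k≰1+i  | yes k≤i = contradiction (s≤s k≤i) 1+k≰1+i

foldr-+-cong : ∀ {m} {a b : Vector ℤ m} → a ≗ b → foldr ℤ._+_ 0ℤ a ≡ foldr ℤ._+_ 0ℤ b
foldr-+-cong {zero}  a≗b = refl
foldr-+-cong {suc m} a≗b = cong₂ ℤ._+_ (a≗b Fin.zero) (foldr-+-cong (λ i → a≗b (Fin.suc i)))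

-- The entries of `c` cancel in pairs, and `g m ≡ 0ℤ` removes the last remaining term. Applied to
-- the b's preceded by 1, this turns the tail sums of (iii) into single b's.
sumFrom-telescope : ∀ {m} (c : Vector ℤ m) (g : ℕ → ℤ) →
  (∀ i → c i ≡ g (toℕ i) ℤ.- g (suc (toℕ i))) → g m ≡ 0ℤ →
  ∀ k → k ℕ.≤ m → sumFrom k c ≡ g k
sumFrom-telescope {zero}  c g c≡ g0 zero    _ = sym g0
sumFrom-telescope {suc m} c g c≡ g0 zero    _ = begin
  c Fin.zero ℤ.+ sumFrom 0 (tail c)
    ≡⟨ cong₂ ℤ._+_ (c≡ Fin.zero)
         (sumFrom-telescope (tail c) (λ j → g (suc j)) (λ i → c≡ (Fin.suc i)) g0 0 z≤n) ⟩
  g 0 ℤ.- g 1 ℤ.+ g 1   ≡⟨ sub-add (g 0) (g 1) ⟩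
  g 0                   ∎
  where
  open ≡-Reasoning
  sub-add : ∀ u v → u ℤ.- v ℤ.+ v ≡ u
  sub-add = solve-∀
sumFrom-telescope {suc m} c g c≡ g0 (suc k) (s≤s k≤m) = begin
  sumFrom (suc k) c     ≡⟨ ℤ.+-identityˡ _ ⟩
  foldr ℤ._+_ 0ℤ (λ i → if ⌊ suc k ℕ.≤? suc (toℕ i) ⌋ then tail c i else 0ℤ)
    ≡⟨ foldr-+-cong (λ i → if-≤-suc k (toℕ i) (tail c i)) ⟩
  sumFrom k (tail c)    ≡⟨ sumFrom-telescope (tail c) (λ j → g (suc j)) (λ i → c≡ (Fin.suc i)) g0 k k≤m ⟩
  g (suc k)             ∎
  where open ≡-Reasoning

-- Conditions (iii) and (iv) both say this about b_{k+1} = shifted -1ℤ f k.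
PositiveMonotone : ∀ {d} → Vector ℤ d → Set
PositiveMonotone {d} f =
  0ℤ ℤ.< shifted -1ℤ f 0 × (∀ k → suc k ℕ.< d → shifted -1ℤ f k ℤ.≤ shifted -1ℤ f (suc k))

PositiveMonotone-cong : ∀ {d} {f g : Vector ℤ d} → f ≗ g → PositiveMonotone f → PositiveMonotone g
PositiveMonotone-cong f≗g (pos , mono) =
    subst (0ℤ ℤ.<_) (shifted-cong -1ℤ f≗g 0) pos
  , λ k 1+k<d → subst₂ ℤ._≤_ (shifted-cong -1ℤ f≗g k) (shifted-cong -1ℤ f≗g (suc k)) (mono k 1+k<d)

module _ {d : ℕ} (f : Vector ℤ (suc d)) where

  private
    B : ℕ → ℤ
    B = shifted -1ℤ f
    neg : ∀ u v → u ℤ.+ -1ℤ ℤ.* v ≡ u ℤ.- v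
    neg = solve-∀

  BCondition⇒PositiveMonotone : BCondition (suc d) f → PositiveMonotone f
  BCondition⇒PositiveMonotone (b , eq , pos , mono) =
      subst (0ℤ ℤ.<_) (b≡ Fin.zero) (pos Fin.zero refl)
    , λ k 1+k<d → subst₂ ℤ._≤_ (atFin (ℕ.<⇒≤ 1+k<d)) (atFin 1+k<d)
        (mono (Fin.fromℕ< (ℕ.<⇒≤ 1+k<d)) (Fin.fromℕ< 1+k<d)
          (trans (toℕ-fromℕ< 1+k<d) (cong suc (sym (toℕ-fromℕ< (ℕ.<⇒≤ 1+k<d))))))
    where
    b≡ = expansion⇒coeffs f b eq
    atFin : ∀ {k} (k<d : k ℕ.< suc d) → b (Fin.fromℕ< k<d) ≡ B k
    atFin k<d = trans (b≡ (Fin.fromℕ< k<d)) (cong B (toℕ-fromℕ< k<d))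

  PositiveMonotone⇒BCondition : PositiveMonotone f → BCondition (suc d) f
  PositiveMonotone⇒BCondition (pos , mono) =
      b , coeffs⇒expansion f b (λ _ → refl)
    , (λ i i≡0 → subst (λ j → 0ℤ ℤ.< B j) (sym i≡0) pos)
    , (λ i j j≡1+i → subst (λ l → B (toℕ i) ℤ.≤ B l) (sym j≡1+i)
                       (mono (toℕ i) (subst (ℕ._< suc d) j≡1+i (toℕ<n j))))
    where
    b : Vector ℤ (suc d)
    b i = B (toℕ i)

  module _ (c : Vector ℤ (suc (suc d))) (c≡ : ∀ i → c i ≡ shifted -1ℤ (1ℤ ◂ f) (toℕ i)) where

    sumFrom-c : ∀ k → suc k ℕ.≤ suc d → sumFrom (suc k) c ≡ B k
    sumFrom-c k 1+k≤d = sumFrom-telescope c g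
      (λ i → trans (c≡ i) (difference (toℕ i))) (shifted-degree -1ℤ f (suc d) ℕ.≤-refl)
      (suc k) (ℕ.m≤n⇒m≤1+n 1+k≤d)
      where
      -- The leading 1 is f₋₁; it lets the constant coefficient 1 - `B 0` be a difference like all
      -- the others.
      g : ℕ → ℤ
      g zero    = 1ℤ
      g (suc k) = B k
      difference : ∀ k → shifted -1ℤ (1ℤ ◂ f) k ≡ g k ℤ.- g (suc k)
      difference zero    = neg 1ℤ (B 0)
      difference (suc k) = neg (B k) (B (suc k))

    c-suc : ∀ i → c (Fin.suc i) ≡ B (toℕ i) ℤ.- B (suc (toℕ i))
    c-suc i = trans (c≡ (Fin.suc i)) (neg (B (toℕ i)) (B (suc (toℕ i))))

  CCondition⇒PositiveMonotone : CCondition (suc d) f → PositiveMonotone f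
  CCondition⇒PositiveMonotone (c , eq , pos , nonpos) =
      subst (0ℤ ℤ.<_) (sumFrom-c c c≡ 0 (s≤s z≤n)) (pos 1 (s≤s z≤n) (s≤s z≤n))
    , λ k 1+k<d → let k<d = ℕ.<⇒≤ 1+k<d ; i = Fin.fromℕ< k<d ; i≡k = toℕ-fromℕ< k<d in
        ℤ.i-j≤0⇒i≤j (subst (ℤ._≤ 0ℤ)
          (trans (c-suc c c≡ i) (cong (λ j → B j ℤ.- B (suc j)) i≡k))
          (nonpos (Fin.suc i) (s≤s z≤n) (subst (λ j → suc j ℕ.< suc d) (sym i≡k) 1+k<d)))
    where c≡ = expansion⇒coeffs (1ℤ ◂ f) c eq

  PositiveMonotone⇒CCondition : PositiveMonotone f → CCondition (suc d) f
  PositiveMonotone⇒CCondition (pos , mono) =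
      c , coeffs⇒expansion (1ℤ ◂ f) c (λ _ → refl)
    , (λ where (suc k) _ 1+k≤d → subst (0ℤ ℤ.<_) (sym (sumFrom-c c (λ _ → refl) k 1+k≤d)) (B-pos k 1+k≤d))
    , (λ where (Fin.suc i) _ 1+i<d → subst (ℤ._≤ 0ℤ) (sym (c-suc c (λ _ → refl) i))
                                       (ℤ.i≤j⇒i-j≤0 (mono (toℕ i) 1+i<d)))
    where
    c : Vector ℤ (suc (suc d))
    c i = shifted -1ℤ (1ℤ ◂ f) (toℕ i)
    B-pos : ∀ k → k ℕ.< suc d → 0ℤ ℤ.< B k
    B-pos zero    _     = pos
    B-pos (suc k) 1+k<d = ℤ.<-≤-trans (B-pos k (ℕ.<⇒≤ 1+k<d)) (mono k 1+k<d)

-- Numerical effect of attaching leaves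

-- The f-vector of a pure quasi-forest whose successive facets, after the
-- first, meet the preceding ones in δ vertices, δ running through the list.
leafFVector : ∀ d → List ℕ → Vector ℤ d
leafFVector d []       i = binomials d d i
leafFVector d (δ ∷ δs) i = leafFVector d δs i ℤ.+ (binomials d d i ℤ.- binomials d δ i)

leafBVector : ℕ → List ℕ → ℕ → ℤ
leafBVector d []       k = ind< k d
leafBVector d (δ ∷ δs) k = leafBVector d δs k ℤ.+ (ind< k d ℤ.- ind< k δ)

shifted-leafFVector : ∀ {d δs} → All (ℕ._< d) δs → ∀ k →
  shifted -1ℤ (leafFVector d δs) k ≡ leafBVector d δs k
shifted-leafFVector {d} []            k = shifted-binomials d d ℕ.≤-refl k
shifted-leafFVector {d} {δ ∷ δs} (δ<d ∷ δs<d) k = begin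
  shifted -1ℤ (leafFVector d (δ ∷ δs)) k
    ≡⟨ shifted-+ -1ℤ (leafFVector d δs) (λ i → binomials d d i ℤ.- binomials d δ i) k ⟩
  shifted -1ℤ (leafFVector d δs) k ℤ.+ shifted -1ℤ (λ i → binomials d d i ℤ.- binomials d δ i) k
    ≡⟨ cong₂ ℤ._+_ (shifted-leafFVector δs<d k) (shifted-- -1ℤ (binomials d d) (binomials d δ) k) ⟩
  leafBVector d δs k ℤ.+ (shifted -1ℤ (binomials d d) k ℤ.- shifted -1ℤ (binomials d δ) k)
    ≡⟨ cong₂ (λ u v → leafBVector d δs k ℤ.+ (u ℤ.- v))
         (shifted-binomials d d ℕ.≤-refl k) (shifted-binomials d δ (ℕ.<⇒≤ δ<d) k) ⟩
  leafBVector d (δ ∷ δs) k ∎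
  where open ≡-Reasoning

leafFVector-PositiveMonotone : ∀ {d δs} → 1 ℕ.≤ d → All (ℕ._< d) δs →
  PositiveMonotone (leafFVector d δs)
leafFVector-PositiveMonotone {d} {δs} 1≤d δs<d =
    subst (0ℤ ℤ.<_) (sym (shifted-leafFVector δs<d 0)) (pos δs)
  , λ k 1+k<d → subst₂ ℤ._≤_ (sym (shifted-leafFVector δs<d k)) (sym (shifted-leafFVector δs<d (suc k)))
                  (mono k 1+k<d δs)
  where
  pos : ∀ δs → 0ℤ ℤ.< leafBVector d δs 0
  pos []       = subst (0ℤ ℤ.<_) (sym (ind<-yes 1≤d)) (ℤ.+<+ (s≤s z≤n))
  pos (δ ∷ δs) = ℤ.+-mono-<-≤ (pos δs)
    (ℤ.i≤j⇒0≤j-i (subst (ind< 0 δ ℤ.≤_) (sym (ind<-yes 1≤d)) (ind<≤1 0 δ)))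
  mono : ∀ k → suc k ℕ.< d → ∀ δs → leafBVector d δs k ℤ.≤ leafBVector d δs (suc k)
  mono k 1+k<d []       = ℤ.≤-reflexive (trans (ind<-yes (ℕ.<⇒≤ 1+k<d)) (sym (ind<-yes 1+k<d)))
  -- Below `d` the term `ind< k d` is constantly 1, which is the base case `mono k 1+k<d []`; the
  -- other term, - `ind< k δ`, can only grow with `k`.
  mono k 1+k<d (δ ∷ δs) = ℤ.+-mono-≤ (mono k 1+k<d δs)
    (ℤ.+-mono-≤ (mono k 1+k<d []) (ℤ.neg-mono-≤ (ind<-antitone k δ)))

count≤ : List ℕ → ℕ → ℤ
count≤ []       k = 0ℤ
count≤ (δ ∷ δs) k = (1ℤ ℤ.- ind< k δ) ℤ.+ count≤ δs k

leafBVector≡1+count≤ : ∀ {d} δs {k} → k ℕ.< d → leafBVector d δs k ≡ 1ℤ ℤ.+ count≤ δs k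
leafBVector≡1+count≤ []               k<d = trans (ind<-yes k<d) (sym (ℤ.+-identityʳ 1ℤ))
leafBVector≡1+count≤ (δ ∷ δs) {k} k<d
  rewrite leafBVector≡1+count≤ δs k<d | ind<-yes k<d = rearrange (count≤ δs k) (ind< k δ)
  where
  rearrange : ∀ u v → (1ℤ ℤ.+ u) ℤ.+ (1ℤ ℤ.- v) ≡ 1ℤ ℤ.+ ((1ℤ ℤ.- v) ℤ.+ u)
  rearrange = solve-∀

count≤-++ : ∀ δs εs k → count≤ (δs ++ εs) k ≡ count≤ δs k ℤ.+ count≤ εs k
count≤-++ []       εs k = sym (ℤ.+-identityˡ _)
count≤-++ (δ ∷ δs) εs k rewrite count≤-++ δs εs k = sym (ℤ.+-assoc (1ℤ ℤ.- ind< k δ) _ _)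

count≤-zeros : ∀ n k → count≤ (replicate n 0) k ≡ + n
count≤-zeros zero    k = refl
count≤-zeros (suc n) k rewrite count≤-zeros n k = refl

count≤-map-suc-zero : ∀ δs → count≤ (map suc δs) 0 ≡ 0ℤ
count≤-map-suc-zero []       = refl
count≤-map-suc-zero (δ ∷ δs) rewrite count≤-map-suc-zero δs = refl

count≤-map-suc-suc : ∀ δs k → count≤ (map suc δs) (suc k) ≡ count≤ δs k
count≤-map-suc-suc []       k = refl
count≤-map-suc-suc (δ ∷ δs) k rewrite count≤-map-suc-suc δs k = refl

-- Let `k` occur g(k+1) - g(k) times. The recursion puts the zeros in front and raises by one the
-- list obtained for the shifted sequence, which keeps the result sorted; monotonicity makes the
-- absolute value in `n` the true difference.
sortedWithCounts : ∀ d (g : ℕ → ℤ) → (∀ k → k ℕ.< d → g k ℤ.≤ g (suc k)) →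
  ∃ λ δs → AllPairs ℕ._≤_ δs × All (ℕ._< d) δs ×
           (∀ k → k ℕ.< d → g 0 ℤ.+ count≤ δs k ≡ g (suc k))
sortedWithCounts zero    g mono = [] , [] , [] , λ _ ()
sortedWithCounts (suc d) g mono
  with δs , sorted , δs<d , counts ← sortedWithCounts d (g ∘ suc) (λ k k<d → mono (suc k) (s≤s k<d)) =
    replicate n 0 ++ map suc δs
  , AllPairs.++⁺ (zeros-sorted n) (AllPairs.map⁺ (AllPairs.map s≤s sorted))
                 (All.replicate⁺ n (All.universal (λ _ → z≤n) _))
  , All.++⁺ (All.replicate⁺ n (s≤s z≤n)) (All.map⁺ (All.map s≤s δs<d))
  , λ where
      zero    _         → trans (cong (λ u → g 0 ℤ.+ u) (split 0 (count≤-map-suc-zero δs)))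
                                (add-zero (g 0) (g 1))
      (suc k) (s≤s k<d) → trans (cong (λ u → g 0 ℤ.+ u) (split (suc k) (count≤-map-suc-suc δs k)))
                                (trans (add-sub (g 0) (g 1) _) (counts k k<d))
  where
  n = ℤ.∣ g 1 ℤ.- g 0 ∣
  zeros-sorted : ∀ n → AllPairs ℕ._≤_ (replicate n 0)
  zeros-sorted zero    = []
  zeros-sorted (suc n) = All.replicate⁺ n z≤n ∷ zeros-sorted n
  split : ∀ {δs} k {u} → count≤ (map suc δs) k ≡ u →
    count≤ (replicate n 0 ++ map suc δs) k ≡ (g 1 ℤ.- g 0) ℤ.+ u
  split {δs} k eq = trans (count≤-++ (replicate n 0) (map suc δs) k)
    (cong₂ ℤ._+_ (trans (count≤-zeros n k) (ℤ.0≤i⇒+∣i∣≡i (ℤ.i≤j⇒0≤j-i (mono 0 (s≤s z≤n))))) eq)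
  add-zero : ∀ u v → u ℤ.+ ((v ℤ.- u) ℤ.+ 0ℤ) ≡ v
  add-zero = solve-∀
  add-sub : ∀ u v w → u ℤ.+ ((v ℤ.- u) ℤ.+ w) ≡ v ℤ.+ w
  add-sub = solve-∀

-- The two vectors are compared through their expansions in x - 1, where the left side is one plus a
-- count below `d` and both sides vanish from `d` on; `shifted-injective` carries the equality back.
positiveMonotone⇒leafFVector : ∀ {d} (f : Vector ℤ d) → PositiveMonotone f →
  ∃ λ δs → AllPairs ℕ._≤_ δs × All (ℕ._< d) δs × (∀ i → leafFVector d δs i ≡ f i)
positiveMonotone⇒leafFVector {d} f (pos , mono) =
  let δs , sorted , δs<d , counts = sortedWithCounts d g g-mono in
    δs , sorted , δs<d , shifted-injective (leafFVector d δs) f (λ k → same δs<d counts k)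
  where
  B = shifted -1ℤ f
  -- The leading 1 stands for the first facet, which contributes no δ; positivity of the first b is
  -- then just the first instance of monotonicity.
  g : ℕ → ℤ
  g zero    = 1ℤ
  g (suc k) = B k
  g-mono : ∀ k → k ℕ.< d → g k ℤ.≤ g (suc k)
  g-mono zero    _     = ℤ.i<j⇒suc[i]≤j pos
  g-mono (suc k) 1+k<d = mono k 1+k<d
  same : ∀ {δs} → All (ℕ._< d) δs → (∀ k → k ℕ.< d → 1ℤ ℤ.+ count≤ δs k ≡ B k) →
    ∀ k → shifted -1ℤ (leafFVector d δs) k ≡ B k
  same {δs} δs<d counts k with k ℕ.<? d
  ... | no k≮d  = trans (shifted-degree -1ℤ (leafFVector d δs) k (ℕ.≮⇒≥ k≮d))
                        (sym (shifted-degree -1ℤ f k (ℕ.≮⇒≥ k≮d)))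
  ... | yes k<d = trans (shifted-leafFVector δs<d k)
                        (trans (leafBVector≡1+count≤ δs k<d) (counts k k<d))

-- Counting subsets

module _ {A B : Set} {P : Pred B 0ℓ} (P? : Decidable P) (f : A → B) where

  length-filter-map : ∀ xs → length (filter P? (map f xs)) ≡ length (filter (P? ∘ f) xs)
  length-filter-map [] = refl
  length-filter-map (x ∷ xs) with P? (f x)
  ... | yes _ = cong suc (length-filter-map xs)
  ... | no  _ = length-filter-map xs

module _ {A : Set} {P Q : Pred A 0ℓ} (P? : Decidable P) (Q? : Decidable Q) where

  filter-filter : ∀ xs → filter Q? (filter P? xs) ≡ filter (P? ∩? Q?) xs
  filter-filter [] = refl
  filter-filter (x ∷ xs) with P? x
  ... | no  _ = filter-filter xs
  ... | yes _ with Q? x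
  ...   | yes _ = cong (x ∷_) (filter-filter xs)
  ...   | no  _ = filter-filter xs

  -- Inclusion-exclusion, kept additive so that no truncated subtraction appears.
  length-filter-∪-∩ : ∀ xs → length (filter (P? ∪? Q?) xs) ℕ.+ length (filter (P? ∩? Q?) xs) ≡
                             length (filter P? xs) ℕ.+ length (filter Q? xs)
  length-filter-∪-∩ [] = refl
  length-filter-∪-∩ (x ∷ xs) with P? x | Q? x
  ... | no  _ | no  _ = length-filter-∪-∩ xs
  ... | yes _ | no  _ = cong suc (length-filter-∪-∩ xs)
  ... | no  _ | yes _ = trans (cong suc (length-filter-∪-∩ xs)) (sym (ℕ.+-suc _ _))
  ... | yes _ | yes _ = cong suc (trans (ℕ.+-suc _ _)
                          (trans (cong suc (length-filter-∪-∩ xs)) (sym (ℕ.+-suc _ _))))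

∈-allSubsets : ∀ {n} (F : Subset n) → F ∈ allSubsets n
∈-allSubsets Vec.[]              = here refl
∈-allSubsets (outside Vec.∷ F) = ∈-++⁺ˡ (∈-map⁺ (outside Vec.∷_) (∈-allSubsets F))
∈-allSubsets (inside  Vec.∷ F) = ∈-++⁺ʳ _ (∈-map⁺ (inside Vec.∷_) (∈-allSubsets F))

allSubsets-unique : ∀ n → Unique (allSubsets n)
allSubsets-unique zero    = [] ∷ []
allSubsets-unique (suc n) = Unique.++⁺
  (Unique.map⁺ Vec.∷-injectiveʳ (allSubsets-unique n))
  (Unique.map⁺ Vec.∷-injectiveʳ (allSubsets-unique n))
  λ (p , q) → let _ , _ , eq₁ = ∈-map⁻ _ p ; _ , _ , eq₂ = ∈-map⁻ _ q in
    contradiction (Vec.∷-injectiveˡ (trans (sym eq₁) eq₂)) λ ()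

infix 4 _≟ₛ_
_≟ₛ_ : ∀ {n} → DecidableEquality (Subset n)
_≟ₛ_ = Vec.≡-dec Bool._≟_

nC0≡1 : ∀ n → n C 0 ≡ 1
nC0≡1 n = trans (nCk≡nC[n∸k] {0} {n} z≤n) (nCn≡1 n)

ofSize? : ∀ {n} k → Decidable (λ (H : Subset n) → ∣ H ∣ ≡ k)
ofSize? k H = ∣ H ∣ ℕ.≟ k

-- Induction on the first vertex: subsets avoiding it are subsets of the tail, and those containing
-- it exist only when `F` does too, with one element less to choose. Pascal's rule adds the two
-- counts.
#subsets : ∀ {n} (F : Subset n) k →
  length (filter ((_⊆? F) ∩? ofSize? k) (allSubsets n)) ≡ ∣ F ∣ C k
#subsets Vec.[] zero    = refl
#subsets Vec.[] (suc k) = sym (k>n⇒nCk≡0 {0} {suc k} (s≤s z≤n))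
#subsets {suc n} (s Vec.∷ F) k = begin
  length (filter P? (map (outside Vec.∷_) (allSubsets n) ++ map (inside Vec.∷_) (allSubsets n)))
    ≡⟨ cong length (filter-++ P? (map (outside Vec.∷_) (allSubsets n)) _) ⟩
  length (filter P? (map (outside Vec.∷_) (allSubsets n)) ++ _)
    ≡⟨ length-++ (filter P? (map (outside Vec.∷_) (allSubsets n))) ⟩
  length (filter P? (map (outside Vec.∷_) (allSubsets n))) ℕ.+
  length (filter P? (map (inside Vec.∷_) (allSubsets n)))
    ≡⟨ cong₂ ℕ._+_ without (length-filter-map P? (inside Vec.∷_) (allSubsets n)) ⟩
  ∣ F ∣ C k ℕ.+ length (filter (P? ∘ (inside Vec.∷_)) (allSubsets n))
    ≡⟨ within s k ⟩
  ∣ s Vec.∷ F ∣ C k ∎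
  where
  open ≡-Reasoning
  P? = (_⊆? (s Vec.∷ F)) ∩? ofSize? k
  without : length (filter P? (map (outside Vec.∷_) (allSubsets n))) ≡ ∣ F ∣ C k
  without = trans (length-filter-map P? (outside Vec.∷_) (allSubsets n))
    (trans (cong length (filter-≐ (P? ∘ (outside Vec.∷_)) ((_⊆? F) ∩? ofSize? k)
              ( (λ (H⊆F , eq) → (λ {x} → drop-∷-⊆ H⊆F {x}) , eq)
              , (λ (H⊆F , eq) → (λ {x} → out⊆ H⊆F {x}) , eq)) (allSubsets n)))
           (#subsets F k))
  within : ∀ s k → ∣ F ∣ C k ℕ.+
    length (filter (((_⊆? (s Vec.∷ F)) ∩? ofSize? k) ∘ (inside Vec.∷_)) (allSubsets n)) ≡ ∣ s Vec.∷ F ∣ C k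
  within outside k = trans (cong (λ xs → ∣ F ∣ C k ℕ.+ length xs)
      (filter-none _ {allSubsets n} (All.universal (λ H (H⊆F , _) → case-here (H⊆F Vec.here)) _)))
    (ℕ.+-identityʳ _)
    where
    case-here : ¬ (Fin.zero ∈ₛ (outside Vec.∷ F))
    case-here ()
  within inside zero = trans (cong (λ xs → ∣ F ∣ C 0 ℕ.+ length xs)
      (filter-none _ {allSubsets n} (All.universal (λ { H (_ , ()) }) _)))
    (trans (ℕ.+-identityʳ _) (trans (nC0≡1 ∣ F ∣) (sym (nC0≡1 (suc ∣ F ∣)))))
  within inside (suc k) = begin
    ∣ F ∣ C suc k ℕ.+
    length (filter (((_⊆? (inside Vec.∷ F)) ∩? ofSize? (suc k)) ∘ (inside Vec.∷_)) (allSubsets n))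
      ≡⟨ cong (λ xs → ∣ F ∣ C suc k ℕ.+ length xs)
           (filter-≐ (((_⊆? (inside Vec.∷ F)) ∩? ofSize? (suc k)) ∘ (inside Vec.∷_)) ((_⊆? F) ∩? ofSize? k)
              ( (λ (H⊆F , eq) → (λ {x} → drop-∷-⊆ H⊆F {x}) , ℕ.suc-injective eq)
              , (λ (H⊆F , eq) → (λ {x} → s⊆s H⊆F {x}) , cong suc eq)) (allSubsets n)) ⟩
    ∣ F ∣ C suc k ℕ.+ length (filter ((_⊆? F) ∩? ofSize? k) (allSubsets n))
      ≡⟨ cong (∣ F ∣ C suc k ℕ.+_) (#subsets F k) ⟩
    ∣ F ∣ C suc k ℕ.+ ∣ F ∣ C k   ≡⟨ ℕ.+-comm (∣ F ∣ C suc k) _ ⟩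
    ∣ F ∣ C k ℕ.+ ∣ F ∣ C suc k   ≡⟨ nCk+nC[k+1]≡[n+1]C[k+1] ∣ F ∣ k ⟩
    suc ∣ F ∣ C suc k             ∎

-- Faces of the complex generated by a list of facets

-- The generated complex as a bare predicate, to be compared both with `Face Δ` and with `Δ ⟨ Fs ⟩`;
-- the list need not cover all vertices.
Under : ∀ {n} → List (Subset n) → Pred (Subset n) 0ℓ
Under Fs H = Any (H ⊆_) Fs

under? : ∀ {n} (Fs : List (Subset n)) → Decidable (Under Fs)
under? Fs H = any? (H ⊆?_) Fs

#under : ∀ {n} → List (Subset n) → ℕ → ℕ
#under {n} Fs k = length (filter (under? Fs ∩? ofSize? k) (allSubsets n))

-- Facets are listed in reverse leaf order, with G a branch of F.
data Leafy {n} (d : ℕ) : List (Subset n) → List ℕ → Set where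
  single : ∀ {F} → ∣ F ∣ ≡ d → Leafy d (F ∷ []) []
  attach : ∀ {F G Gs δs} → Leafy d Gs δs → ∣ F ∣ ≡ d → G ∈ Gs →
           (∀ {H} → H ∈ Gs → H ∩ F ⊆ G) → ∣ G ∩ F ∣ ℕ.< d →
           Leafy d (F ∷ Gs) (∣ G ∩ F ∣ ∷ δs)

Leafy-small : ∀ {n d δs} {Fs : List (Subset n)} → Leafy d Fs δs → All (ℕ._< d) δs
Leafy-small (single _)             = []
Leafy-small (attach L _ _ _ δ<d) = δ<d ∷ Leafy-small L

#under-single : ∀ {n} (F : Subset n) k → #under (F ∷ []) k ≡ ∣ F ∣ C k
#under-single {n} F k = trans
  (cong length (filter-≐ (under? (F ∷ []) ∩? ofSize? k) ((_⊆? F) ∩? ofSize? k)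
    ((λ { (here H⊆F , eq) → (λ {x} → H⊆F {x}) , eq }) , (λ (H⊆F , eq) → here H⊆F , eq)) (allSubsets n)))
  (#subsets F k)

-- Inclusion-exclusion: since every earlier facet meets `F` inside `G`, the sets lying both in `F`
-- and under `Gs` are exactly the subsets of `G ∩ F`.
#under-attach : ∀ {n} {F G : Subset n} {Gs} k → G ∈ Gs → (∀ {H} → H ∈ Gs → H ∩ F ⊆ G) →
  #under (F ∷ Gs) k ℕ.+ ∣ G ∩ F ∣ C k ≡ #under Gs k ℕ.+ ∣ F ∣ C k
#under-attach {n} {F} {G} {Gs} k G∈Gs branch = begin
  #under (F ∷ Gs) k ℕ.+ ∣ G ∩ F ∣ C k
    ≡⟨ cong₂ ℕ._+_
         (cong length (filter-≐ (under? (F ∷ Gs) ∩? ofSize? k) (P? ∪? Q?)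
            ( (λ { (here H⊆F , eq) → inj₂ ((λ {x} → H⊆F {x}) , eq)
                 ; (there p , eq)  → inj₁ (p , eq) })
            , [ (λ (p , eq) → there p , eq) , (λ (H⊆F , eq) → here H⊆F , eq) ]) (allSubsets n)))
         (trans (sym (#subsets (G ∩ F) k))
           (cong length (filter-≐ ((_⊆? (G ∩ F)) ∩? ofSize? k) (P? ∩? Q?)
             ( (λ {H} (H⊆ , eq) → (lose G∈Gs (λ {x} → ⊆-trans {i = H} H⊆ (p∩q⊆p G F) {x}) , eq)
                                , ((λ {x} → ⊆-trans {i = H} H⊆ (p∩q⊆q G F) {x}) , eq))
             , (λ {H} ((p , eq) , (H⊆F , _)) → let H′ , H′∈Gs , H⊆H′ = find p in
                  (λ {x} x∈H → x∈p∩q⁺ (branch H′∈Gs (x∈p∩q⁺ (H⊆H′ x∈H , H⊆F x∈H)) , H⊆F x∈H)) , eq))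
             (allSubsets n)))) ⟩
  length (filter (P? ∪? Q?) (allSubsets n)) ℕ.+ length (filter (P? ∩? Q?) (allSubsets n))
    ≡⟨ length-filter-∪-∩ P? Q? (allSubsets n) ⟩
  #under Gs k ℕ.+ length (filter Q? (allSubsets n))
    ≡⟨ cong (#under Gs k ℕ.+_) (#subsets F k) ⟩
  #under Gs k ℕ.+ ∣ F ∣ C k ∎
  where
  open ≡-Reasoning
  P? = under? Gs ∩? ofSize? k
  Q? = (_⊆? F) ∩? ofSize? k

#under-Leafy : ∀ {n d δs} {Fs : List (Subset n)} → Leafy d Fs δs → ∀ (i : Fin d) →
  + #under Fs (suc (toℕ i)) ≡ leafFVector d δs i
#under-Leafy (single {F} refl) i = cong +_ (#under-single F (suc (toℕ i)))
#under-Leafy (attach {F} {G} {Gs} {δs} L refl G∈Gs branch _) i = begin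
  + #under (F ∷ Gs) k
    ≡⟨ add-sub (+ #under (F ∷ Gs) k) (+ (∣ G ∩ F ∣ C k)) ⟩
  + #under (F ∷ Gs) k ℤ.+ + (∣ G ∩ F ∣ C k) ℤ.- + (∣ G ∩ F ∣ C k)
    ≡⟨ cong (ℤ._- + (∣ G ∩ F ∣ C k)) (trans (sym (ℤ.pos-+ (#under (F ∷ Gs) k) _))
         (trans (cong +_ (#under-attach k G∈Gs branch)) (ℤ.pos-+ (#under Gs k) _))) ⟩
  + #under Gs k ℤ.+ + (∣ F ∣ C k) ℤ.- + (∣ G ∩ F ∣ C k)
    ≡⟨ ℤ.+-assoc (+ #under Gs k) (+ (∣ F ∣ C k)) (ℤ.- + (∣ G ∩ F ∣ C k)) ⟩
  + #under Gs k ℤ.+ (+ (∣ F ∣ C k) ℤ.- + (∣ G ∩ F ∣ C k))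
    ≡⟨ cong (ℤ._+ (+ (∣ F ∣ C k) ℤ.- + (∣ G ∩ F ∣ C k))) (#under-Leafy L i) ⟩
  leafFVector ∣ F ∣ (∣ G ∩ F ∣ ∷ δs) i ∎
  where
  open ≡-Reasoning
  k = suc (toℕ i)
  add-sub : ∀ u v → u ≡ u ℤ.+ v ℤ.- v
  add-sub = solve-∀

fNumber≡#under : ∀ {n} (Δ : SimplicialComplex n) Fs → Face Δ ≐ Under Fs → ∀ i →
  fNumber Δ i ≡ #under Fs (suc i)
fNumber≡#under {n} Δ Fs (Face⇒ , ⇒Face) i = cong length (trans
  (filter-filter (Face? Δ) (ofSize? (suc i)) (allSubsets n))
  (filter-≐ (Face? Δ ∩? ofSize? (suc i)) (under? Fs ∩? ofSize? (suc i))
    ((λ (p , eq) → Face⇒ p , eq) , (λ (p , eq) → ⇒Face p , eq)) (allSubsets n)))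

-- Facets and leaves of pure complexes

⊆∧≥⇒≡ : ∀ {n} {F G : Subset n} → F ⊆ G → ∣ G ∣ ℕ.≤ ∣ F ∣ → F ≡ G
⊆∧≥⇒≡ {F = Vec.[]}            {Vec.[]}            _   _  = refl
⊆∧≥⇒≡ {F = outside Vec.∷ F} {outside Vec.∷ G} F⊆G ≥  = cong (outside Vec.∷_) (⊆∧≥⇒≡ (drop-∷-⊆ F⊆G) ≥)
⊆∧≥⇒≡ {F = inside Vec.∷ F}  {inside Vec.∷ G}  F⊆G ≥  = cong (inside Vec.∷_) (⊆∧≥⇒≡ (drop-∷-⊆ F⊆G) (ℕ.s≤s⁻¹ ≥))
⊆∧≥⇒≡ {F = outside Vec.∷ F} {inside Vec.∷ G}  F⊆G ≥  =
  contradiction ≥ (ℕ.<⇒≱ (s≤s (p⊆q⇒∣p∣≤∣q∣ (drop-∷-⊆ F⊆G))))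
⊆∧≥⇒≡ {F = inside Vec.∷ F}  {outside Vec.∷ G} F⊆G ≥ with () ← F⊆G Vec.here

-- Source of the bound δ < d for facets attached along a leaf order.
equalSize-∩< : ∀ {n} {F G : Subset n} → G ≢ F → ∣ G ∣ ≡ ∣ F ∣ → ∣ G ∩ F ∣ ℕ.< ∣ F ∣
equalSize-∩< {F = F} {G} G≢F ∣G∣≡∣F∣ = ℕ.≤∧≢⇒< (∣p∩q∣≤∣q∣ G F) λ eq →
  let F≡G∩F = sym (⊆∧≥⇒≡ (p∩q⊆q G F) (ℕ.≤-reflexive (sym eq))) in
  G≢F (sym (⊆∧≥⇒≡ (λ {x} x∈F → p∩q⊆p G F (subst (x ∈ₛ_) F≡G∩F x∈F)) (ℕ.≤-reflexive ∣G∣≡∣F∣)))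

-- The leaf condition read off the list itself, so that recursion over lists need not mention the
-- facets of the changing subcomplexes.
LeafOf : ∀ {n} → List (Subset n) → Pred (Subset n) 0ℓ
LeafOf Fs F = F ∈ Fs × ∃ λ G → G ∈ Fs × G ≢ F × (∀ H → H ∈ Fs → H ≢ F → H ∩ F ⊆ G ∩ F)

module _ {n d : ℕ} {K : Pred (Subset n) 0ℓ} {Fs : List (Subset n)}
         (K≐ : K ≐ Under Fs) (sizes : ∀ {F} → F ∈ Fs → ∣ F ∣ ≡ d) where

  -- A face above `F` lies under some member of the list, and that member is no larger than `F`; all
  -- three sets therefore coincide.
  ∈⇒IsFacet : ∀ {F} → F ∈ Fs → IsFacet K F
  ∈⇒IsFacet {F} F∈Fs = proj₂ K≐ (lose F∈Fs ⊆-refl) , λ G KG F⊆G →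
    let H , H∈Fs , G⊆H = find (proj₁ K≐ KG) in
    sym (⊆∧≥⇒≡ F⊆G (ℕ.≤-trans (p⊆q⇒∣p∣≤∣q∣ G⊆H) (ℕ.≤-reflexive (trans (sizes H∈Fs) (sym (sizes F∈Fs))))))

  IsFacet⇒∈ : ∀ {F} → IsFacet K F → F ∈ Fs
  IsFacet⇒∈ (KF , max) =
    let H , H∈Fs , F⊆H = find (proj₁ K≐ KF) in
    subst (_∈ Fs) (max H (proj₂ K≐ (lose H∈Fs ⊆-refl)) F⊆H) H∈Fs

  IsLeaf⇒LeafOf : ∀ {F} → IsLeaf K F → LeafOf Fs F
  IsLeaf⇒LeafOf (F-facet , G , G-facet , G≢F , branch) =
    IsFacet⇒∈ F-facet , G , IsFacet⇒∈ G-facet , G≢F , λ H H∈Fs → branch H (∈⇒IsFacet H∈Fs)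

  LeafOf⇒IsLeaf : ∀ {F} → LeafOf Fs F → IsLeaf K F
  LeafOf⇒IsLeaf (F∈Fs , G , G∈Fs , G≢F , branch) =
    ∈⇒IsFacet F∈Fs , G , ∈⇒IsFacet G∈Fs , G≢F , λ H H-facet → branch H (IsFacet⇒∈ H-facet)

∈-faces : ∀ {n} (Δ : SimplicialComplex n) {F} → Face Δ F → F ∈ faces Δ
∈-faces Δ {F} = ∈-filter⁺ (Face? Δ) (∈-allSubsets F)

∈-faces⁻ : ∀ {n} (Δ : SimplicialComplex n) {F} → F ∈ faces Δ → Face Δ F
∈-faces⁻ {n} Δ F∈ = proj₂ (∈-filter⁻ (Face? Δ) {xs = allSubsets n} F∈)

-- A face of greatest cardinality among those above `G` is maximal. The default value of `argmax` is
-- `G`, which is itself a face above `G`, so either outcome of `argmax-sel` will do.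
⊆-facet : ∀ {n} (Δ : SimplicialComplex n) {G} → Face Δ G → ∃ λ F → IsFacet (Face Δ) F × G ⊆ F
⊆-facet {n} Δ {G} G-face = F , (proj₁ F-props , maximal) , proj₂ F-props
  where
  above : List (Subset n)
  above = filter (G ⊆?_) (faces Δ)
  F : Subset n
  F = argmax ∣_∣ G above
  F-props : Face Δ F × G ⊆ F
  F-props with argmax-sel ∣_∣ G above
  ... | inj₁ F≡G = subst (λ H → Face Δ H × G ⊆ H) (sym F≡G) (G-face , id)
  ... | inj₂ F∈  = let F∈faces , G⊆F = ∈-filter⁻ (G ⊆?_) {xs = faces Δ} F∈ in
                   ∈-faces⁻ Δ F∈faces , λ {x} → G⊆F {x}
  maximal : ∀ H → Face Δ H → F ⊆ H → H ≡ F
  maximal H H-face F⊆H = sym (⊆∧≥⇒≡ F⊆H (All.lookup (f[xs]≤f[argmax] {f = ∣_∣} G above)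
    (∈-filter⁺ (G ⊆?_) (∈-faces Δ H-face) (λ {x} x∈G → F⊆H (proj₂ F-props x∈G)))))

facets≐ : ∀ {n} (Δ : SimplicialComplex n) {Fs} → (∀ F → F ∈ Fs ⇔ IsFacet (Face Δ) F) →
  Face Δ ≐ Under Fs
facets≐ Δ ⇔facet =
    (λ G-face → let F , F-facet , G⊆F = ⊆-facet Δ G-face in lose (from (⇔facet F) F-facet) G⊆F)
  , (λ p → let F , F∈Fs , G⊆F = find p in downClosed Δ G⊆F (proj₁ (to (⇔facet F) F∈Fs)))

⟨⟩≐ : ∀ {n} (Δ : SimplicialComplex n) {Fs} → (∀ {F} → F ∈ Fs → Face Δ F) → Δ ⟨ Fs ⟩ ≐ Under Fs
⟨⟩≐ Δ Fs-faces = proj₂ , λ p → let F , F∈Fs , G⊆F = find p in downClosed Δ G⊆F (Fs-faces F∈Fs) , p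

∣face∣≤maxFaceSize : ∀ {n} (Δ : SimplicialComplex n) {F} → Face Δ F → ∣ F ∣ ℕ.≤ maxFaceSize Δ
∣face∣≤maxFaceSize Δ F-face =
  All.lookup (xs≤max 0 (map ∣_∣ (faces Δ))) (∈-map⁺ ∣_∣ (∈-faces Δ F-face))

largest-face : ∀ {n} (Δ : SimplicialComplex n) → 1 ℕ.≤ maxFaceSize Δ →
  ∃ λ F → Face Δ F × ∣ F ∣ ≡ maxFaceSize Δ
largest-face Δ 1≤d with argmax-sel id 0 (map ∣_∣ (faces Δ))
-- The value 0 may be the default of `max`, attained by no face; `1≤d` excludes it.
... | inj₁ max≡0 = contradiction max≡0 (ℕ.>⇒≢ 1≤d)
... | inj₂ max∈  = let F , F∈ , eq = ∈-map⁻ ∣_∣ max∈ in F , ∈-faces⁻ Δ F∈ , sym eq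

largest-IsFacet : ∀ {n} (Δ : SimplicialComplex n) {F} → Face Δ F → ∣ F ∣ ≡ maxFaceSize Δ →
  IsFacet (Face Δ) F
largest-IsFacet Δ F-face eq = F-face , λ G G-face F⊆G →
  sym (⊆∧≥⇒≡ F⊆G (ℕ.≤-trans (∣face∣≤maxFaceSize Δ G-face) (ℕ.≤-reflexive (sym eq))))

module _ {n : ℕ} (Δ : SimplicialComplex n) (pure : IsPure Δ) (1≤d : 1 ℕ.≤ maxFaceSize Δ) where

  ∣facet∣ : ∀ {F} → IsFacet (Face Δ) F → ∣ F ∣ ≡ maxFaceSize Δ
  ∣facet∣ F-facet = let G , G-face , eq = largest-face Δ 1≤d in
    trans (pure _ G F-facet (largest-IsFacet Δ G-face eq)) eq

  leaf-in-⟨⟩ : ∀ {Fs} → (∀ {F} → F ∈ Fs → IsFacet (Face Δ) F) →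
    ∀ {F} → IsLeaf (Δ ⟨ Fs ⟩) F ⇔ LeafOf Fs F
  leaf-in-⟨⟩ Fs-facets = mk⇔ (IsLeaf⇒LeafOf K≐ sizes) (LeafOf⇒IsLeaf K≐ sizes)
    where
    K≐ = ⟨⟩≐ Δ (λ F∈ → proj₁ (Fs-facets F∈))
    sizes = λ {F} F∈ → ∣facet∣ (Fs-facets {F} F∈)

-- Leaf orders as iterated attachment

-- `P` receives the position and the whole prefix, so that recursion on the list can absorb a
-- dropped head into `P`.
Prefixes : {A : Set} → (ℕ → List A → A → Set) → List A → Set
Prefixes P xs = ∀ j → P (toℕ j) (take (suc (toℕ j)) xs) (lookup xs j)

prefixes-split : ∀ {A : Set} {P : ℕ → List A → A → Set} xs {y ys} →
  Prefixes P (xs ++ y ∷ ys) → P (length xs) (xs ∷ʳ y) y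
prefixes-split         []       H = H Fin.zero
prefixes-split {P = P} (x ∷ xs) H =
  prefixes-split {P = λ j ts → P (suc j) (x ∷ ts)} xs (λ j → H (Fin.suc j))

prefixes-∷ʳ : ∀ {A : Set} {P : ℕ → List A → A → Set} xs {y} →
  Prefixes P xs → P (length xs) (xs ∷ʳ y) y → Prefixes P (xs ∷ʳ y)
prefixes-∷ʳ         []       _ p Fin.zero    = p
prefixes-∷ʳ         (x ∷ xs) H p Fin.zero    = H Fin.zero
prefixes-∷ʳ {P = P} (x ∷ xs) H p (Fin.suc j) =
  prefixes-∷ʳ {P = λ j ts → P (suc j) (x ∷ ts)} xs (λ j → H (Fin.suc j)) p j

unique-split : ∀ {A : Set} (xs : List A) {y ys x} → Unique (xs ++ y ∷ ys) → x ∈ xs → x ≢ y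
unique-split (x ∷ xs) (x∉ ∷ _) (here refl) = All.lookup x∉ (∈-++⁺ʳ xs (here refl))
unique-split (x ∷ xs) (_ ∷ u)  (there p)   = unique-split xs u p

LeafAt : ∀ {n} → ℕ → List (Subset n) → Subset n → Set
LeafAt j Fs F = 0 ℕ.< j → LeafOf Fs F

module _ {n d : ℕ} {Fs : List (Subset n)} (unique : Unique Fs)
         (sizes : ∀ {F} → F ∈ Fs → ∣ F ∣ ≡ d) (leaves : Prefixes LeafAt Fs) where

  -- `xs` is the part already processed. A leaf order grows at its end and `Leafy` at its head, so
  -- only equality of members is carried along; the conditions in `Leafy` ask for nothing finer.
  leafOrder⇒Leafy-from : ∀ xs ys {Gs δs} → Fs ≡ xs ++ ys → 0 ℕ.< length xs → Leafy d Gs δs →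
    (∀ {F} → F ∈ Gs ⇔ F ∈ xs) → ∃₂ λ Gs δs → Leafy d Gs δs × (∀ {F} → F ∈ Gs ⇔ F ∈ Fs)
  leafOrder⇒Leafy-from xs [] {Gs} {δs} Fs≡ 0<xs L same = Gs , δs , L , λ {F} → mk⇔
    (λ F∈ → subst (F ∈_) (sym Fs≡) (∈-++⁺ˡ (to same F∈)))
    (λ F∈ → [ from same , (λ ()) ] (∈-++⁻ xs (subst (F ∈_) Fs≡ F∈)))
  leafOrder⇒Leafy-from xs (y ∷ ys) {Gs} Fs≡ 0<xs L same
    with _ , G , G∈ , G≢y , branch ←
      prefixes-split {P = LeafAt} xs (subst (Prefixes LeafAt) Fs≡ leaves) 0<xs =
    leafOrder⇒Leafy-from (xs ∷ʳ y) ys (trans Fs≡ (sym (++-assoc xs (y ∷ []) ys)))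
      (subst (0 ℕ.<_) (sym (length-++ xs)) (ℕ.≤-trans 0<xs (ℕ.m≤m+n _ _)))
      (attach L ∣y∣ (from same G∈xs)
        (λ {H} H∈ → ⊆-trans {i = H ∩ y} (branch H (∈-++⁺ˡ (to same H∈)) (≢y (to same H∈))) (p∩q⊆p G y))
        (subst (∣ G ∩ y ∣ ℕ.<_) ∣y∣ (equalSize-∩< G≢y (trans (∈Fs G∈xs) (sym ∣y∣)))))
      (λ {F} → mk⇔ (λ { (here refl) → ∈-++⁺ʳ xs (here refl) ; (there F∈) → ∈-++⁺ˡ (to same F∈) })
                   (λ F∈ → [ (λ F∈xs → there (from same F∈xs)) , (λ { (here refl) → here refl }) ] (∈-++⁻ xs F∈)))
    where
    ∣y∣ : ∣ y ∣ ≡ d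
    ∣y∣ = sizes (subst (y ∈_) (sym Fs≡) (∈-++⁺ʳ xs (here refl)))
    ∈Fs : ∀ {F} → F ∈ xs → ∣ F ∣ ≡ d
    ∈Fs {F} F∈ = sizes (subst (F ∈_) (sym Fs≡) (∈-++⁺ˡ F∈))
    ≢y : ∀ {F} → F ∈ xs → F ≢ y
    ≢y = unique-split xs (subst Unique Fs≡ unique)
    G∈xs : G ∈ xs
    G∈xs = [ id , (λ { (here G≡y) → contradiction G≡y G≢y }) ] (∈-++⁻ xs G∈)

leafOrder⇒Leafy : ∀ {n d} {Fs : List (Subset n)} {F₀} → F₀ ∈ Fs → Unique Fs →
  (∀ {F} → F ∈ Fs → ∣ F ∣ ≡ d) → Prefixes LeafAt Fs →
  ∃₂ λ Gs δs → Leafy d Gs δs × (∀ {F} → F ∈ Gs ⇔ F ∈ Fs)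
leafOrder⇒Leafy {Fs = F ∷ Fs} _ unique sizes leaves =
  leafOrder⇒Leafy-from unique sizes leaves (F ∷ []) Fs refl (s≤s z≤n)
    (single (sizes (here refl))) (mk⇔ id id)

dim⇒maxFaceSize : ∀ {n} (Δ : SimplicialComplex n) d → dim Δ ≡ + d ℤ.- 1ℤ → maxFaceSize Δ ≡ d
dim⇒maxFaceSize Δ d eq = ℤ.+-injective (+-cancelʳ-≡ (ℤ.- 1ℤ) _ _ eq)

∈-take⁻ : ∀ {A : Set} m (xs : List A) {x} → x ∈ take m xs → x ∈ xs
∈-take⁻ (suc m) (y ∷ xs) (here eq) = here eq
∈-take⁻ (suc m) (y ∷ xs) (there p) = there (∈-take⁻ m xs p)

quasiForest⇒positiveMonotone : ∀ {d} (f : Vector ℤ d) → 1 ℕ.≤ d →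
  PureQuasiForestExists d f → PositiveMonotone f
quasiForest⇒positiveMonotone {d} f 1≤d (n , Δ , pure , (Fs , unique , ⇔facet , leaves) , dimΔ , fΔ)
  with refl ← dim⇒maxFaceSize Δ d dimΔ =
  let G , G-face , eq = largest-face Δ 1≤d
      Gs , δs , L , same = leafOrder⇒Leafy {Fs = Fs} (from (⇔facet G) (largest-IsFacet Δ G-face eq)) unique
        (λ {F} F∈ → ∣facet∣ Δ pure 1≤d (to (⇔facet F) F∈))
        (λ j 0<j → to (leaf-in-⟨⟩ Δ pure 1≤d
                         (λ {F} F∈ → to (⇔facet F) (∈-take⁻ (suc (toℕ j)) Fs F∈)))
                      (leaves j 0<j))
      K≐ = facets≐ Δ {Gs} (λ F → mk⇔ (λ F∈ → to (⇔facet F) (to same F∈))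
                                     (λ F-facet → from same (from (⇔facet F) F-facet)))
      f≡ = λ i → trans (sym (#under-Leafy L i))
                       (trans (cong +_ (sym (fNumber≡#under Δ Gs K≐ (toℕ i)))) (fΔ i))
  in PositiveMonotone-cong f≡ (leafFVector-PositiveMonotone 1≤d (Leafy-small L))

-- Pure forests are quasi-forests

module _ {n : ℕ} (Δ : SimplicialComplex n) (pure : IsPure Δ) (forest : IsForest Δ)
         (1≤d : 1 ℕ.≤ maxFaceSize Δ) where

  -- A leaf of the whole family may come last, since the condition at a position concerns only the
  -- prefix ending there; the rest is ordered recursively. The bound `m` provides termination, as
  -- filtering is not structural.
  peel : ∀ m Fs → length Fs ℕ.≤ m → Fs ≢ [] → Unique Fs → (∀ {F} → F ∈ Fs → IsFacet (Face Δ) F) →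
    ∃ λ Gs → Unique Gs × (∀ {F} → F ∈ Gs ⇔ F ∈ Fs) × Prefixes LeafAt Gs
  peel zero    [] _ Fs≢[] = contradiction refl Fs≢[]
  peel (suc m) Fs ≤m Fs≢[] unique Fs-facets with forest Fs Fs≢[] (All.tabulate Fs-facets)
  -- A single facet and no repetitions leave a list of one entry, where no position is positive.
  ... | inj₁ (F , _ , only) = Fs , unique , mk⇔ id id , vacuous Fs unique
          (λ G∈ → only _ (∈⇒IsFacet K≐ sizes G∈))
    where
    K≐ = ⟨⟩≐ Δ (λ F∈ → proj₁ (Fs-facets F∈))
    sizes = λ {F} F∈ → ∣facet∣ Δ pure 1≤d (Fs-facets {F} F∈)
    vacuous : ∀ Gs → Unique Gs → (∀ {G} → G ∈ Gs → G ≡ F) → Prefixes LeafAt Gs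
    vacuous (G ∷ [])     _ _ Fin.zero ()
    vacuous (G ∷ H ∷ Gs) ((G≢H ∷ _) ∷ _) all≡ =
      contradiction (trans (all≡ (here refl)) (sym (all≡ (there (here refl))))) G≢H
  ... | inj₂ (F , F-leaf)
    with F∈Fs , G , G∈Fs , G≢F , branch ← to (leaf-in-⟨⟩ Δ pure 1≤d Fs-facets) F-leaf
    with Gs , Gs-unique , same , leaves ←
      peel m (filter (λ H → ¬? (H ≟ₛ F)) Fs)
        (ℕ.s≤s⁻¹ (ℕ.≤-trans (filter-notAll _ Fs (lose F∈Fs (λ F≢F → F≢F refl))) ≤m))
        -- The branch `G` survives the removal of `F`, so something is left to order.
        (λ eq → ¬Any[] (subst (G ∈_) eq (∈-filter⁺ (λ H → ¬? (H ≟ₛ F)) G∈Fs G≢F)))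
        (Unique.filter⁺ _ unique)
        (λ H∈ → Fs-facets (proj₁ (∈-filter⁻ (λ H → ¬? (H ≟ₛ F)) {xs = Fs} H∈))) =
      Gs ∷ʳ F
    , Unique.++⁺ Gs-unique ([] ∷ []) (λ { (H∈ , here refl) → proj₂ (back H∈) refl })
    , (λ {H} → mk⇔ forth′ (back′ H))
    , prefixes-∷ʳ {P = LeafAt} Gs leaves (λ _ →
          ∈-++⁺ʳ Gs (here refl) , G , back′ G G∈Fs , G≢F
        , λ H H∈ → branch H (forth′ H∈))
    where
    back : ∀ {H} → H ∈ Gs → H ∈ Fs × H ≢ F
    back H∈ = ∈-filter⁻ (λ H → ¬? (H ≟ₛ F)) {xs = Fs} (to same H∈)
    forth′ : ∀ {H} → H ∈ Gs ∷ʳ F → H ∈ Fs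
    forth′ H∈ = [ (λ H∈Gs → proj₁ (back H∈Gs)) , (λ { (here refl) → F∈Fs }) ] (∈-++⁻ Gs H∈)
    back′ : ∀ H → H ∈ Fs → H ∈ Gs ∷ʳ F
    back′ H H∈ with H ≟ₛ F
    ... | yes refl = ∈-++⁺ʳ Gs (here refl)
    ... | no H≢F   = ∈-++⁺ˡ (from same (∈-filter⁺ (λ H → ¬? (H ≟ₛ F)) H∈ H≢F))

  forest⇒quasiForest : IsQuasiForest Δ
  forest⇒quasiForest =
    let Gs , unique , same , leaves =
          peel (length facets) facets ℕ.≤-refl nonempty
            (Unique.filter⁺ _ (Unique.filter⁺ _ (allSubsets-unique n))) (to facet⇔)
        Gs⇔facet = λ F → mk⇔ (λ F∈ → to facet⇔ (to same F∈))
                             (λ F-facet → from same (from (facet⇔ {F}) F-facet))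
    in Gs , unique , Gs⇔facet , λ j 0<j →
         from (leaf-in-⟨⟩ Δ pure 1≤d
                (λ {F} F∈ → to (Gs⇔facet F) (∈-take⁻ (suc (toℕ j)) Gs F∈)))
              (leaves j 0<j)
    where
    -- By purity the facets are the faces of greatest size, a decidable criterion that yields a list
    -- without repetitions.
    facets : List (Subset n)
    facets = filter (ofSize? (maxFaceSize Δ)) (faces Δ)
    facet⇔ : ∀ {F} → F ∈ facets ⇔ IsFacet (Face Δ) F
    facet⇔ = mk⇔
      (λ F∈ → let F∈faces , eq = ∈-filter⁻ (ofSize? (maxFaceSize Δ)) {xs = faces Δ} F∈ in
              largest-IsFacet Δ (∈-faces⁻ Δ F∈faces) eq)
      (λ F-facet → ∈-filter⁺ (ofSize? (maxFaceSize Δ)) (∈-faces Δ (proj₁ F-facet)) (∣facet∣ Δ pure 1≤d F-facet))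
    nonempty : facets ≢ []
    nonempty eq with F , F-face , ∣F∣ ← largest-face Δ 1≤d
      with () ← subst (F ∈_) eq (from facet⇔ (largest-IsFacet Δ F-face ∣F∣))

-- Forests from b-vectors

-- Stronger than `Leafy`, since a forest concerns every subfamily of facets and a chosen branch may
-- be missing from one. A common intersection `D` makes all earlier facets interchangeable as
-- branches.
data Nested {n} (d : ℕ) : List (Subset n) → List ℕ → Set where
  single : ∀ {F} → ∣ F ∣ ≡ d → Nested d (F ∷ []) []
  attach : ∀ {F D Gs δs} → Nested d Gs δs → ∣ F ∣ ≡ d → ∣ D ∣ ℕ.< d →
           (∀ {H} → H ∈ Gs → H ∩ F ≡ D) → Nested d (F ∷ Gs) (∣ D ∣ ∷ δs)

Nested⇒Leafy : ∀ {n d δs} {Fs : List (Subset n)} → Nested d Fs δs → Leafy d Fs δs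
Nested⇒Leafy (single ∣F∣) = single ∣F∣
Nested⇒Leafy {d = d} (attach {F} {D} {Gs} {δs} N ∣F∣ D<d meet) = go (some N)
  where
  some : ∀ {Gs δs} → Nested d Gs δs → ∃ (_∈ Gs)
  some (single _)       = _ , here refl
  some (attach _ _ _ _) = _ , here refl
  go : ∃ (_∈ Gs) → Leafy d (F ∷ Gs) (∣ D ∣ ∷ δs)
  go (G , G∈Gs) = subst (λ K → Leafy d (F ∷ Gs) (∣ K ∣ ∷ δs)) (meet G∈Gs)
    (attach (Nested⇒Leafy N) ∣F∣ G∈Gs
      (λ H∈Gs {x} x∈ → p∩q⊆p G F (subst (x ∈ₛ_) (trans (meet H∈Gs) (sym (meet G∈Gs))) x∈))
      (subst (λ K → ∣ K ∣ ℕ.< d) (sym (meet G∈Gs)) D<d))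

Nested-sizes : ∀ {n d δs} {Fs : List (Subset n)} → Nested d Fs δs → ∀ {F} → F ∈ Fs → ∣ F ∣ ≡ d
Nested-sizes (single ∣F∣)       (here refl) = ∣F∣
Nested-sizes (attach _ ∣F∣ _ _) (here refl) = ∣F∣
Nested-sizes (attach N _ _ _)   (there F∈)  = Nested-sizes N F∈

-- The first facet of Fs that occurs in a subfamily is a leaf of it, and any
-- other member is a branch.
Nested⇒leaf : ∀ {n d δs} {Fs : List (Subset n)} → Nested d Fs δs →
  ∀ Es → Es ≢ [] → (∀ {F} → F ∈ Es → F ∈ Fs) →
  (∃ λ F → F ∈ Es × (∀ {G} → G ∈ Es → G ≡ F)) ⊎ ∃ (LeafOf Es)
Nested⇒leaf N                      []       Es≢[] _  = contradiction refl Es≢[]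
Nested⇒leaf (single {F} _)         (E ∷ Es) _     Es⊆ = inj₁ (E , here refl , λ G∈ →
  trans (only (Es⊆ G∈)) (sym (only (Es⊆ (here refl)))))
  where
  only : ∀ {G} → G ∈ F ∷ [] → G ≡ F
  only (here eq) = eq
Nested⇒leaf (attach {F} {D} {Gs} N _ _ meet) Es@(_ ∷ _) Es≢[] Es⊆ with any? (F ≟ₛ_) Es
... | no F∉Es = Nested⇒leaf N Es Es≢[] (λ G∈ → drop-F (Es⊆ G∈) (λ { refl → F∉Es G∈ }))
  where
  drop-F : ∀ {G} → G ∈ F ∷ Gs → G ≢ F → G ∈ Gs
  drop-F (here G≡F) G≢F = contradiction G≡F G≢F
  drop-F (there p)  _   = p
... | yes F∈Es with any? (λ G → ¬? (G ≟ₛ F)) Es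
...   | no none  = inj₁ (F , F∈Es , λ {G} G∈ → decide G∈)
  where
  decide : ∀ {G} → G ∈ Es → G ≡ F
  decide {G} G∈ with G ≟ₛ F
  ... | yes eq = eq
  ... | no G≢F = contradiction (lose G∈ G≢F) none
...   | yes other = let G , G∈Es , G≢F = find other in
  inj₂ (F , F∈Es , G , G∈Es , G≢F , λ H H∈Es H≢F {x} →
    subst (x ∈ₛ_) (trans (meets H∈Es H≢F) (sym (meets G∈Es G≢F))))
  where
  meets : ∀ {H} → H ∈ Es → H ≢ F → H ∩ F ≡ D
  meets H∈Es H≢F with Es⊆ H∈Es
  ... | here H≡F = contradiction H≡F H≢F
  ... | there p  = meet p

-- Subsets of an enlarged vertex set, with the new vertices in front

∣++∣ : ∀ {m n} (F : Subset m) (G : Subset n) → ∣ F Vec.++ G ∣ ≡ ∣ F ∣ ℕ.+ ∣ G ∣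
∣++∣ Vec.[]              G = refl
∣++∣ (outside Vec.∷ F) G = ∣++∣ F G
∣++∣ (inside Vec.∷ F)  G = cong suc (∣++∣ F G)

∣⊥++∣ : ∀ {n} m (G : Subset n) → ∣ ⊥ {m} Vec.++ G ∣ ≡ ∣ G ∣
∣⊥++∣ m G = trans (∣++∣ (⊥ {m}) G) (cong (ℕ._+ ∣ G ∣) (∣⊥∣≡0 m))

⊥++-⊆ : ∀ {m n} (F : Subset m) {G H : Subset n} → G ⊆ H → ⊥ {m} Vec.++ G ⊆ F Vec.++ H
⊥++-⊆ Vec.[]      G⊆H = G⊆H
⊥++-⊆ (_ Vec.∷ F) G⊆H = out⊆ (⊥++-⊆ F G⊆H)

⊥++-∩ : ∀ {m n} (F : Subset m) (G H : Subset n) →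
  (⊥ {m} Vec.++ G) ∩ (F Vec.++ H) ≡ ⊥ {m} Vec.++ (G ∩ H)
⊥++-∩ Vec.[]      G H = refl
⊥++-∩ (_ Vec.∷ F) G H = cong (outside Vec.∷_) (⊥++-∩ F G H)

∈-++ˡ : ∀ {m n} {F : Subset m} (G : Subset n) {x} → x ∈ₛ F → (x Fin.↑ˡ n) ∈ₛ (F Vec.++ G)
∈-++ˡ G Vec.here      = Vec.here
∈-++ˡ G (Vec.there p) = Vec.there (∈-++ˡ G p)

∈-++ʳ : ∀ {m n} (F : Subset m) {G : Subset n} {x} → x ∈ₛ G → (m Fin.↑ʳ x) ∈ₛ (F Vec.++ G)
∈-++ʳ Vec.[]      p = p
∈-++ʳ (_ Vec.∷ F) p = Vec.there (∈-++ʳ F p)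

subset-ofSize : ∀ {n} (F : Subset n) δ → δ ℕ.≤ ∣ F ∣ → ∃ λ G → G ⊆ F × ∣ G ∣ ≡ δ
subset-ofSize Vec.[]              zero    _     = Vec.[] , id , refl
subset-ofSize (outside Vec.∷ F) δ       δ≤    =
  let G , G⊆F , ∣G∣ = subset-ofSize F δ δ≤ in outside Vec.∷ G , out⊆ G⊆F , ∣G∣
subset-ofSize {suc n} (inside Vec.∷ F) zero _ = ⊥ , ⊥⊆ , ∣⊥∣≡0 (suc n)
subset-ofSize (inside Vec.∷ F)  (suc δ) (s≤s δ≤) =
  let G , G⊆F , ∣G∣ = subset-ofSize F δ δ≤ in inside Vec.∷ G , s⊆s G⊆F , cong suc ∣G∣

⊆⇒∩≡ : ∀ {n} {F G : Subset n} → F ⊆ G → G ∩ F ≡ F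
⊆⇒∩≡ {F = F} {G} F⊆G = ⊆-antisym (p∩q⊆q G F) (λ x∈F → x∈p∩q⁺ (F⊆G x∈F , x∈F))

Nested-⊥++ : ∀ {n d δs} {Fs : List (Subset n)} m → Nested d Fs δs →
  Nested d (map (⊥ {m} Vec.++_) Fs) δs
Nested-⊥++ m (single {F} ∣F∣) = single (trans (∣⊥++∣ m F) ∣F∣)
Nested-⊥++ {d = d} m (attach {F} {D} {Gs} {δs} N ∣F∣ D<d meet) =
  subst (λ δ → Nested d (map (⊥ {m} Vec.++_) (F ∷ Gs)) (δ ∷ δs)) (∣⊥++∣ m D)
    (attach {D = ⊥ {m} Vec.++ D} (Nested-⊥++ m N) (trans (∣⊥++∣ m F) ∣F∣)
      (subst (ℕ._< d) (sym (∣⊥++∣ m D)) D<d)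
      (λ H∈ → let H , H∈Gs , eq = ∈-map⁻ _ H∈ in
        trans (cong (_∩ (⊥ {m} Vec.++ F)) eq)
              (trans (⊥++-∩ (⊥ {m}) H F) (cong (⊥ {m} Vec.++_) (meet H∈Gs)))))

-- The induction hypothesis of the construction. `core` is the reservoir of common vertices from
-- which the next intersection is cut, and `≤∣core∣` says that it suffices for every δ up to `d` not
-- exceeding those already used. `covers` supplies the singleton faces.
record Family (d : ℕ) (δs : List ℕ) : Set where
  field
    n      : ℕ
    facets : List (Subset n)
    nested : Nested d facets δs
    covers : ∀ i → ∃ λ F → F ∈ facets × i ∈ₛ F
    core   : Subset n
    core⊆  : ∀ {F} → F ∈ facets → core ⊆ F
    ≤∣core∣ : ∀ δ → δ ℕ.≤ d → All (δ ℕ.≤_) δs → δ ℕ.≤ ∣ core ∣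

-- The facet added for δ consists of δ vertices common to all earlier facets
-- and d − δ new ones.
family : ∀ d δs → AllPairs ℕ._≤_ δs → All (ℕ._< d) δs → Family d δs
family d [] _ _ = record
  { n = d ; facets = ⊤ ∷ [] ; nested = single (∣⊤∣≡n d)
  ; covers = λ i → ⊤ , here refl , ∈⊤
  ; core = ⊤ ; core⊆ = λ { (here refl) → id }
  ; ≤∣core∣ = λ δ δ≤d _ → subst (δ ℕ.≤_) (sym (∣⊤∣≡n d)) δ≤d }
family d (δ ∷ δs) (δ≤δs ∷ sorted) (δ<d ∷ δs<d)
  with Φ ← family d δs sorted δs<d
  with D , D⊆core , refl ← subset-ofSize (Family.core Φ) δ (Family.≤∣core∣ Φ δ (ℕ.<⇒≤ δ<d) δ≤δs) = record
  { n = m ℕ.+ n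
  ; facets = F ∷ map (⊥ {m} Vec.++_) facets
  ; nested = subst (λ δ → Nested d (F ∷ map (⊥ {m} Vec.++_) facets) (δ ∷ δs)) (∣⊥++∣ m D)
      (attach {D = ⊥ {m} Vec.++ D} (Nested-⊥++ m nested)
        (trans (∣++∣ (⊤ {m}) D) (trans (cong (ℕ._+ ∣ D ∣) (∣⊤∣≡n m)) (ℕ.m∸n+n≡m (ℕ.<⇒≤ δ<d))))
        (subst (ℕ._< d) (sym (∣⊥++∣ m D)) δ<d)
        (λ H∈ → let H , H∈facets , eq = ∈-map⁻ _ H∈ in
          trans (cong (_∩ F) eq) (trans (⊥++-∩ (⊤ {m}) H D)
            (cong (⊥ {m} Vec.++_) (⊆⇒∩≡ (λ x∈D → core⊆ H∈facets (D⊆core x∈D)))))))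
  ; covers = covers′
  -- The new facet shares exactly `D` with the earlier ones, so the reservoir shrinks to `D`; a
  -- decreasing order of the δ keeps it large enough.
  ; core = ⊥ {m} Vec.++ D
  ; core⊆ = λ where
      (here refl) → ⊥++-⊆ (⊤ {m}) {D} id
      (there H∈) {x} → let H , H∈facets , eq = ∈-map⁻ _ H∈ in
        λ x∈ → subst (x ∈ₛ_) (sym eq) (⊥++-⊆ (⊥ {m}) (λ x∈D → core⊆ H∈facets (D⊆core x∈D)) x∈)
  ; ≤∣core∣ = λ { δ′ _ (δ′≤δ ∷ _) → subst (δ′ ℕ.≤_) (sym (∣⊥++∣ m D)) δ′≤δ } }
  where
  open Family Φ
  m = d ℕ.∸ ∣ D ∣
  F = ⊤ {m} Vec.++ D
  covers′ : ∀ i → ∃ λ G → G ∈ F ∷ map (⊥ {m} Vec.++_) facets × i ∈ₛ G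
  covers′ i with Fin.splitAt m i in eq
  ... | inj₁ j = F , here refl , subst (_∈ₛ F) (splitAt⁻¹-↑ˡ eq) (∈-++ˡ D ∈⊤)
  ... | inj₂ j = let G , G∈ , j∈G = covers j in
      ⊥ {m} Vec.++ G , there (∈-map⁺ _ G∈)
    , subst (_∈ₛ ⊥ {m} Vec.++ G) (splitAt⁻¹-↑ʳ eq) (∈-++ʳ (⊥ {m}) j∈G)

generated : ∀ {n} (Fs : List (Subset n)) → (∀ i → ∃ λ F → F ∈ Fs × i ∈ₛ F) → SimplicialComplex n
generated Fs covers = record
  { Face = Under Fs ; Face? = under? Fs
  ; vertex = λ i → let F , F∈ , i∈F = covers i in
      lose F∈ (λ {x} x∈ → subst (_∈ₛ F) (sym (x∈⁅y⁆⇒x≡y i x∈)) i∈F)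
  ; downClosed = λ G⊆F → Any.map (λ F⊆E {x} x∈G → F⊆E (G⊆F x∈G)) }

-- The complex generated by a nested family

module _ {d : ℕ} {δs : List ℕ} (Φ : Family d δs) where
  open Family Φ

  private
    Δ : SimplicialComplex n
    Δ = generated facets covers
    Δ≐ : Face Δ ≐ Under facets
    Δ≐ = id , id
    sizes = Nested-sizes nested

  generated-pure : IsPure Δ
  generated-pure F G F-facet G-facet =
    trans (sizes (IsFacet⇒∈ Δ≐ sizes F-facet)) (sym (sizes (IsFacet⇒∈ Δ≐ sizes G-facet)))

  generated-dim : dim Δ ≡ + d ℤ.- 1ℤ
  generated-dim = cong (λ k → + k ℤ.- 1ℤ) (ℕ.≤-antisym
    (max≤v⁺ {xs = map ∣_∣ (faces Δ)} z≤n (All.map⁺ (All.tabulate λ F∈ →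
      let G , G∈ , F⊆G = find (∈-faces⁻ Δ F∈) in
      ℕ.≤-trans (p⊆q⇒∣p∣≤∣q∣ F⊆G) (ℕ.≤-reflexive (sizes G∈)))))
    (attained nested))
    where
    -- Either constructor exhibits a facet of size `d` at the head, so the family is not empty.
    attained : Nested d facets δs → d ℕ.≤ maxFaceSize Δ
    attained (single {F} ∣F∣) =
      subst (ℕ._≤ maxFaceSize Δ) ∣F∣ (∣face∣≤maxFaceSize Δ {F} (here id))
    attained (attach {F} _ ∣F∣ _ _) =
      subst (ℕ._≤ maxFaceSize Δ) ∣F∣ (∣face∣≤maxFaceSize Δ {F} (here id))

  generated-forest : IsForest Δ
  generated-forest Es Es≢[] Es-facets = Sum.map
    (λ (F , F∈ , only) → F , ∈⇒IsFacet Es≐ Es-sizes F∈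
                           , λ G G-facet → only (IsFacet⇒∈ Es≐ Es-sizes G-facet))
    (λ (F , F-leaf) → F , LeafOf⇒IsLeaf Es≐ Es-sizes F-leaf)
    (Nested⇒leaf nested Es Es≢[] Es⊆)
    where
    Es⊆ : ∀ {F} → F ∈ Es → F ∈ facets
    Es⊆ F∈ = IsFacet⇒∈ Δ≐ sizes (All.lookup Es-facets F∈)
    Es≐ = ⟨⟩≐ Δ (λ F∈ → proj₁ (All.lookup Es-facets F∈))
    Es-sizes = λ {F} F∈ → sizes (Es⊆ {F} F∈)

  generated-fNumber : ∀ i → + fNumber Δ (toℕ i) ≡ leafFVector d δs i
  generated-fNumber i =
    trans (cong +_ (fNumber≡#under Δ facets Δ≐ (toℕ i))) (#under-Leafy (Nested⇒Leafy nested) i)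

-- Assembling the equivalences

positiveMonotone⇒forest : ∀ {d} (f : Vector ℤ d) → PositiveMonotone f → PureForestExists d f
positiveMonotone⇒forest {d} f pm =
  let δs , sorted , δs<d , f≡ = positiveMonotone⇒leafFVector f pm
      Φ = family d δs sorted δs<d
  in Family.n Φ , generated (Family.facets Φ) (Family.covers Φ)
   , generated-pure Φ , generated-forest Φ , generated-dim Φ
   , λ i → trans (generated-fNumber Φ i) (f≡ i)

forest⇒quasiForestExists : ∀ {d} (f : Vector ℤ d) → 1 ℕ.≤ d →
  PureForestExists d f → PureQuasiForestExists d f
forest⇒quasiForestExists {d} f 1≤d (n , Δ , pure , forest , dimΔ , fΔ) =
    n , Δ , pure
  , forest⇒quasiForest Δ pure forest (subst (1 ℕ.≤_) (sym (dim⇒maxFaceSize Δ d dimΔ)) 1≤d)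
  , dimΔ , fΔ

theorem1p2 : (d : ℕ) → 1 ≤ d → (f : Vector ℤ d) → (∀ (i : Fin d) → 0ℤ < f i) →
    (PureQuasiForestExists d f ⇔ PureForestExists d f)
    × (PureForestExists d f ⇔ CCondition d f)
    × (CCondition d f ⇔ BCondition d f)
theorem1p2 (suc d) 1≤d f _ =
    mk⇔ (pm⇒ii ∘ i⇒pm) ii⇒i
  , mk⇔ (PositiveMonotone⇒CCondition f ∘ i⇒pm ∘ ii⇒i) (pm⇒ii ∘ CCondition⇒PositiveMonotone f)
  , mk⇔ (PositiveMonotone⇒BCondition f ∘ CCondition⇒PositiveMonotone f)
        (PositiveMonotone⇒CCondition f ∘ BCondition⇒PositiveMonotone f)
  where
  i⇒pm  = quasiForest⇒positiveMonotone f 1≤d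
  ii⇒i  = forest⇒quasiForestExists f 1≤d
  pm⇒ii = positiveMonotone⇒forest f
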